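{- Assume $n$ is large enough and $10\le c\le\log n$. In the noisy model with parameter $\gamma$ there is a randomized algorithm for FINDMIN on $n$ elements (with parameter $c$) that has query complexity $\frac{3cn}{\gamma^2}$ and solves FINDMIN with probability at least $1-e^{ -\Omega(c)}$.
   Context: Setting. The input is a set of $n$ elements with an unknown total order, presented in uniformly random order (the elements are a priori indistinguishable). FINDMIN: output the minimum element. Algorithms access the order only through pairwise comparison queries, which may be made adaptively in any number of rounds and with repetition (resampling). Query complexity is the total number of comparisons. Noisy model with parameter $\gamma$: each comparison independently returns the correct answer with probability $1/2+\gamma/2$ and the incorrect answer with probability $1/2-\gamma/2$. The success probability is over the random input order, the comparison outcomes and the algorithm's randomness. -}

module Defs where

open import Data.Bool.Base using (if_then_else_)
open import Data.Fin.Base as Fin using (Fin)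
open import Data.Fin.Permutation using (Permutation′; _⟨$⟩ʳ_; insert)
import Data.Fin.Permutation as Perm
import Data.Fin.Properties as Fin
open import Data.Integer.Base as ℤ using (+_; -[1+_])
import Data.Integer.Properties as ℤ
open import Data.List.Base as List using (List; []; _∷_; map; concatMap; allFin)
open import Data.Nat.Base as ℕ using (ℕ; zero; suc; _!)
import Data.Nat.Properties as ℕ
open import Data.Product.Base using (_×_; _,_; ∃; proj₁; proj₂)
open import Data.Rational.Base as ℚ using (ℚ; mkℚ; 0ℚ; 1ℚ; ½; ∣_∣)
import Data.Rational.Properties as ℚ
open import Data.Rational.Solver using (module +-*-Solver)
open import Data.Sum.Base using (inj₁; inj₂)
open import Relation.Nullary using (Dec; does)
open import Relation.Binary.PropositionalEquality using (_≡_; _≢_; refl; sym; trans; cong; cong₂; subst)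

module Sequences where

  open import Data.Rational.Base using (_+_; _*_; _-_; -_; _≤_; _<_; 1/_)
  open +-*-Solver using (solve; _:+_; _:*_; _:-_; :-_; _:=_)

  ℕtoℚ : ℕ → ℚ
  ℕtoℚ n = (+ n) ℚ./ 1

  0≤1 : 0ℚ ≤ 1ℚ
  0≤1 = ℚ.≤ᵇ⇒≤ _

  0<1 : 0ℚ < 1ℚ
  0<1 = ℚ.positive⁻¹ 1ℚ

  +-nonneg : ∀ {p q} → 0ℚ ≤ p → 0ℚ ≤ q → 0ℚ ≤ p + q
  +-nonneg = ℚ.+-mono-≤

  mulʳ : ∀ r {p q} → 0ℚ ≤ r → p ≤ q → p * r ≤ q * r
  mulʳ r 0≤r p≤q = ℚ.*-monoʳ-≤-nonNeg r {{ℚ.nonNegative 0≤r}} p≤q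

  mulˡ : ∀ r {p q} → 0ℚ ≤ r → p ≤ q → r * p ≤ r * q
  mulˡ r 0≤r p≤q = ℚ.*-monoˡ-≤-nonNeg r {{ℚ.nonNegative 0≤r}} p≤q

  *-nonneg : ∀ {p q} → 0ℚ ≤ p → 0ℚ ≤ q → 0ℚ ≤ p * q
  *-nonneg {p} {q} 0≤p 0≤q = subst (_≤ p * q) (ℚ.*-zeroˡ q) (mulʳ q 0≤q 0≤p)

  *-pos : ∀ {p q} → 0ℚ < p → 0ℚ < q → 0ℚ < p * q
  *-pos {p} {q} 0<p 0<q = ℚ.positive⁻¹ (p * q) {{ℚ.pos*pos⇒pos p {{ℚ.positive 0<p}} q {{ℚ.positive 0<q}}}}

  mul-mono : ∀ {a b c d} → 0ℚ ≤ c → 0ℚ ≤ b → a ≤ b → c ≤ d → a * c ≤ b * d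
  mul-mono {a} {b} {c} 0≤c 0≤b a≤b c≤d = ℚ.≤-trans (mulʳ c 0≤c a≤b) (mulˡ b 0≤b c≤d)

  x≤x+y : ∀ x {y} → 0ℚ ≤ y → x ≤ x + y
  x≤x+y x {y} 0≤y = subst (_≤ x + y) (ℚ.+-identityʳ x) (ℚ.+-monoʳ-≤ x 0≤y)

  inverse : (p : ℚ) → 0ℚ < p → ℚ
  inverse p 0<p = (1/ p) {{ℚ.>-nonZero 0<p}}

  *-inverse : ∀ p (0<p : 0ℚ < p) → p * inverse p 0<p ≡ 1ℚ
  *-inverse p 0<p = ℚ.*-inverseʳ p {{ℚ.>-nonZero 0<p}}

  inverse-pos : ∀ p (0<p : 0ℚ < p) → 0ℚ < inverse p 0<p
  inverse-pos p 0<p = ℚ.positive⁻¹ _ {{ℚ.1/pos⇒pos p {{ℚ.positive 0<p}}}}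

  inverse-anti : ∀ d u (0<d : 0ℚ < d) (0<u : 0ℚ < u) → d ≤ u → inverse u 0<u ≤ inverse d 0<d
  inverse-anti d u 0<d 0<u d≤u = begin
    iu             ≡⟨ trans (sym (ℚ.*-identityˡ iu)) (cong (_* iu) (sym (*-inverse d 0<d))) ⟩
    d * id * iu    ≤⟨ mulʳ iu (ℚ.<⇒≤ (inverse-pos u 0<u)) (mulʳ id (ℚ.<⇒≤ (inverse-pos d 0<d)) d≤u) ⟩
    u * id * iu    ≡⟨ solve 3 (λ x y z → x :* y :* z := (x :* z) :* y) refl u id iu ⟩
    (u * iu) * id  ≡⟨ cong (_* id) (*-inverse u 0<u) ⟩
    1ℚ * id        ≡⟨ ℚ.*-identityˡ id ⟩
    id             ∎
    where
    open ℚ.≤-Reasoning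
    iu = inverse u 0<u
    id = inverse d 0<d

  inverse-sub : ∀ u v (0<u : 0ℚ < u) (0<v : 0ℚ < v) →
                inverse u 0<u - inverse v 0<v ≡ (inverse u 0<u * inverse v 0<v) * (v - u)
  inverse-sub u v 0<u 0<v = sym (begin
    (iu * iv) * (v - u)              ≡⟨ solve 4 (λ u v x y → (x :* y) :* (v :- u) := x :* (v :* y) :- y :* (u :* x)) refl u v iu iv ⟩
    iu * (v * iv) - iv * (u * iu)    ≡⟨ cong₂ (λ a b → iu * a - iv * b) (*-inverse v 0<v) (*-inverse u 0<u) ⟩
    iu * 1ℚ - iv * 1ℚ                ≡⟨ cong₂ _-_ (ℚ.*-identityʳ iu) (ℚ.*-identityʳ iv) ⟩
    iu - iv                          ∎)
    where
    open Relation.Binary.PropositionalEquality.≡-Reasoning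
    iu = inverse u 0<u
    iv = inverse v 0<v

  triangle : ∀ a b c → ∣ a - c ∣ ≤ ∣ a - b ∣ + ∣ b - c ∣
  triangle a b c = subst (λ t → ∣ t ∣ ≤ ∣ a - b ∣ + ∣ b - c ∣)
    (solve 3 (λ a b c → (a :- b) :+ (b :- c) := a :- c) refl a b c)
    (ℚ.∣p+q∣≤∣p∣+∣q∣ (a - b) (b - c))

  ∣∣-swap : ∀ a b → ∣ a - b ∣ ≡ ∣ b - a ∣
  ∣∣-swap a b = trans (sym (ℚ.∣-p∣≡∣p∣ (a - b))) (cong ∣_∣ (solve 2 (λ a b → :- (a :- b) := b :- a) refl a b))

  ∣∣-split : ∀ a b → ∣ a ∣ ≤ ∣ b ∣ + ∣ a - b ∣
  ∣∣-split a b = subst (λ t → ∣ t ∣ ≤ ∣ b ∣ + ∣ a - b ∣)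
    (solve 2 (λ a b → b :+ (a :- b) := a) refl a b)
    (ℚ.∣p+q∣≤∣p∣+∣q∣ b (a - b))

  ∣a-a∣≡0 : ∀ a → ∣ a - a ∣ ≡ 0ℚ
  ∣a-a∣≡0 a = cong ∣_∣ (ℚ.+-inverseʳ a)

  ∣ab-cd∣ : ∀ a b c d → ∣ a * b - c * d ∣ ≤ ∣ a ∣ * ∣ b - d ∣ + ∣ d ∣ * ∣ a - c ∣
  ∣ab-cd∣ a b c d = begin
    ∣ a * b - c * d ∣                  ≡⟨ cong ∣_∣ (solve 4 (λ a b c d → a :* b :- c :* d := a :* (b :- d) :+ d :* (a :- c)) refl a b c d) ⟩
    ∣ a * (b - d) + d * (a - c) ∣      ≤⟨ ℚ.∣p+q∣≤∣p∣+∣q∣ (a * (b - d)) (d * (a - c)) ⟩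
    ∣ a * (b - d) ∣ + ∣ d * (a - c) ∣  ≡⟨ cong₂ _+_ (ℚ.∣p*q∣≡∣p∣*∣q∣ a (b - d)) (ℚ.∣p*q∣≡∣p∣*∣q∣ d (a - c)) ⟩
    ∣ a ∣ * ∣ b - d ∣ + ∣ d ∣ * ∣ a - c ∣ ∎
    where open ℚ.≤-Reasoning

  ℕtoℚ-suc : ∀ n → ℕtoℚ (suc n) ≡ 1ℚ + ℕtoℚ n
  ℕtoℚ-suc n = ℚ.toℚᵘ-injective (ℚᵘ.≃-trans (lemma (suc n)) (ℚᵘ.≃-trans (ℚᵘ.*≡* (arith n))
    (ℚᵘ.≃-sym (ℚᵘ.≃-trans (ℚ.toℚᵘ-homo-+ 1ℚ (ℕtoℚ n)) (ℚᵘ.+-congʳ ℚᵘ.1ℚᵘ (lemma n))))))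
    where
    import Data.Rational.Unnormalised.Base as ℚᵘ
    import Data.Rational.Unnormalised.Properties as ℚᵘ
    lemma : ∀ n → ℚ.toℚᵘ (ℕtoℚ n) ℚᵘ.≃ (+ n) ℚᵘ./ 1
    lemma n = ℚ.toℚᵘ-fromℚᵘ ((+ n) ℚᵘ./ 1)
    arith : ∀ n → (+ suc n) ℤ.* (+ 1) ≡ (((+ 1) ℤ.* (+ 1)) ℤ.+ ((+ n) ℤ.* (+ 1))) ℤ.* (+ 1)
    arith n rewrite ℤ.*-identityʳ (+ n) = refl

  ℕtoℚ-nonneg : ∀ n → 0ℚ ≤ ℕtoℚ n
  ℕtoℚ-nonneg zero = ℚ.≤-refl
  ℕtoℚ-nonneg (suc n) = subst (0ℚ ≤_) (sym (ℕtoℚ-suc n)) (+-nonneg 0≤1 (ℕtoℚ-nonneg n))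

  ℕtoℚ-+ : ∀ m n → ℕtoℚ m ≤ ℕtoℚ (m ℕ.+ n)
  ℕtoℚ-+ zero n = ℕtoℚ-nonneg n
  ℕtoℚ-+ (suc m) n rewrite ℕtoℚ-suc m | ℕtoℚ-suc (m ℕ.+ n) = ℚ.+-monoʳ-≤ 1ℚ (ℕtoℚ-+ m n)

  ℕtoℚ-mono : ∀ {m n} → m ℕ.≤ n → ℕtoℚ m ≤ ℕtoℚ n
  ℕtoℚ-mono {m} {n} m≤n = subst (λ k → ℕtoℚ m ≤ ℕtoℚ k) (ℕ.m+[n∸m]≡n m≤n) (ℕtoℚ-+ m (n ℕ.∸ m))

  archimedean : ∀ q → ∃ λ n → q ≤ ℕtoℚ n
  archimedean q@(mkℚ k d _) = ℤ.∣ k ∣ , ℚ.toℚᵘ-cancel-≤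
    (ℚᵘ.≤-respʳ-≃ (ℚᵘ.≃-sym (ℚ.toℚᵘ-fromℚᵘ ((+ ℤ.∣ k ∣) ℚᵘ./ 1))) (ℚᵘ.*≤* (lemma k)))
    where
    import Data.Rational.Unnormalised.Base as ℚᵘ
    import Data.Rational.Unnormalised.Properties as ℚᵘ
    lemma : ∀ k → k ℤ.* (+ 1) ℤ.≤ (+ ℤ.∣ k ∣) ℤ.* (+ suc d)
    lemma (+ n) = subst (ℤ._≤ (+ n) ℤ.* (+ suc d)) refl
      (subst₂′ (ℤ.+≤+ (ℕ.*-monoʳ-≤ n (ℕ.s≤s (ℕ.z≤n {d})))))
      where
      subst₂′ : (+ (n ℕ.* 1)) ℤ.≤ (+ (n ℕ.* suc d)) → (+ n) ℤ.* (+ 1) ℤ.≤ (+ n) ℤ.* (+ suc d)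
      subst₂′ p rewrite sym (ℤ.pos-* n 1) | sym (ℤ.pos-* n (suc d)) = p
    lemma -[1+ n ] = ℤ.-≤+

  IsCauchy : (ℕ → ℚ) → Set
  IsCauchy s = ∀ ε → 0ℚ ℚ.< ε → ∃ λ N → ∀ m n → N ℕ.≤ m → N ℕ.≤ n → ∣ s m ℚ.- s n ∣ ℚ.≤ ε

  shrink : ∀ B → 0ℚ ≤ B → ∀ ε → 0ℚ < ε → ∃ λ δ → 0ℚ < δ × B * δ ≤ ε
  shrink B 0≤B ε 0<ε = ε * i , *-pos 0<ε (inverse-pos _ 0<B+1) , (begin
    B * (ε * i)         ≤⟨ mulʳ (ε * i) (ℚ.<⇒≤ (*-pos 0<ε (inverse-pos _ 0<B+1))) (x≤x+y B 0≤1) ⟩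
    (B + 1ℚ) * (ε * i)  ≡⟨ solve 3 (λ b e i → b :* (e :* i) := e :* (b :* i)) refl (B + 1ℚ) ε i ⟩
    ε * ((B + 1ℚ) * i)  ≡⟨ cong (ε *_) (*-inverse _ 0<B+1) ⟩
    ε * 1ℚ              ≡⟨ ℚ.*-identityʳ ε ⟩
    ε                   ∎)
    where
    open ℚ.≤-Reasoning
    0<B+1 : 0ℚ < B + 1ℚ
    0<B+1 = ℚ.+-mono-≤-< 0≤B 0<1
    i = inverse (B + 1ℚ) 0<B+1

  -- It suffices to be Cauchy up to a fixed factor B.
  cauchy-scaled : ∀ s B → 0ℚ ≤ B →
    (∀ δ → 0ℚ < δ → ∃ λ N → ∀ m n → N ℕ.≤ m → N ℕ.≤ n → ∣ s m - s n ∣ ≤ B * δ) → IsCauchy s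
  cauchy-scaled s B 0≤B h ε 0<ε =
    let δ , 0<δ , Bδ≤ε = shrink B 0≤B ε 0<ε
        N , f = h δ 0<δ
    in N , λ m n N≤m N≤n → ℚ.≤-trans (f m n N≤m N≤n) Bδ≤ε

  bounded : ∀ s → IsCauchy s → ∃ λ B → 0ℚ ≤ B × ∃ λ N → ∀ n → N ℕ.≤ n → ∣ s n ∣ ≤ B
  bounded s c =
    let N , f = c 1ℚ 0<1
    in ∣ s N ∣ + 1ℚ , +-nonneg (ℚ.0≤∣p∣ (s N)) 0≤1 , N , λ n N≤n →
    ℚ.≤-trans (∣∣-split (s n) (s N)) (ℚ.+-monoʳ-≤ ∣ s N ∣ (f n N N≤n ℕ.≤-refl))

  const-cauchy : ∀ q → IsCauchy (λ _ → q)
  const-cauchy q ε 0<ε = 0 , λ _ _ _ _ → subst (_≤ ε) (sym (∣a-a∣≡0 q)) (ℚ.<⇒≤ 0<ε)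

  +-cauchy : ∀ s t → IsCauchy s → IsCauchy t → IsCauchy (λ n → s n + t n)
  +-cauchy s t cs ct = cauchy-scaled (λ n → s n + t n) (1ℚ + 1ℚ) (+-nonneg 0≤1 0≤1) λ δ 0<δ →
    let M , f = cs δ 0<δ
        N , g = ct δ 0<δ
    in M ℕ.⊔ N , λ m n p q → let open ℚ.≤-Reasoning in begin
      ∣ (s m + t m) - (s n + t n) ∣    ≡⟨ cong ∣_∣ (solve 4 (λ a b c d → (a :+ b) :- (c :+ d) := (a :- c) :+ (b :- d)) refl (s m) (t m) (s n) (t n)) ⟩
      ∣ (s m - s n) + (t m - t n) ∣    ≤⟨ ℚ.∣p+q∣≤∣p∣+∣q∣ (s m - s n) (t m - t n) ⟩
      ∣ s m - s n ∣ + ∣ t m - t n ∣    ≤⟨ ℚ.+-mono-≤ (f m n (ℕ.m⊔n≤o⇒m≤o M N p) (ℕ.m⊔n≤o⇒m≤o M N q))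
                                                   (g m n (ℕ.m⊔n≤o⇒n≤o M N p) (ℕ.m⊔n≤o⇒n≤o M N q)) ⟩
      δ + δ                            ≡⟨ sym (cong₂ _+_ (ℚ.*-identityˡ δ) (ℚ.*-identityˡ δ)) ⟩
      1ℚ * δ + 1ℚ * δ                  ≡⟨ sym (ℚ.*-distribʳ-+ δ 1ℚ 1ℚ) ⟩
      (1ℚ + 1ℚ) * δ                    ∎

  neg-cauchy : ∀ s → IsCauchy s → IsCauchy (λ n → - s n)
  neg-cauchy s c ε 0<ε =
    let N , f = c ε 0<ε
    in N , λ m n p q → subst (_≤ ε)
    (trans (sym (ℚ.∣-p∣≡∣p∣ (s m - s n))) (cong ∣_∣ (solve 2 (λ a b → :- (a :- b) := (:- a) :- (:- b)) refl (s m) (s n))))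
    (f m n p q)

  *-cauchy : ∀ s t → IsCauchy s → IsCauchy t → IsCauchy (λ n → s n * t n)
  *-cauchy s t cs ct =
    let B , 0≤B , K , b = bounded s cs
        C , 0≤C , L , c = bounded t ct
    in cauchy-scaled (λ n → s n * t n) (B + C) (+-nonneg 0≤B 0≤C) λ δ 0<δ →
    let M , f = cs δ 0<δ
        N , g = ct δ 0<δ
        KL = K ℕ.⊔ L
        MN = M ℕ.⊔ N
        k : ∀ {m} → KL ℕ.⊔ MN ℕ.≤ m → K ℕ.≤ m
        k p = ℕ.m⊔n≤o⇒m≤o K L (ℕ.m⊔n≤o⇒m≤o KL MN p)
        l : ∀ {m} → KL ℕ.⊔ MN ℕ.≤ m → L ℕ.≤ m
        l p = ℕ.m⊔n≤o⇒n≤o K L (ℕ.m⊔n≤o⇒m≤o KL MN p)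
        u : ∀ {m} → KL ℕ.⊔ MN ℕ.≤ m → M ℕ.≤ m
        u p = ℕ.m⊔n≤o⇒m≤o M N (ℕ.m⊔n≤o⇒n≤o KL MN p)
        v : ∀ {m} → KL ℕ.⊔ MN ℕ.≤ m → N ℕ.≤ m
        v p = ℕ.m⊔n≤o⇒n≤o M N (ℕ.m⊔n≤o⇒n≤o KL MN p)
    in KL ℕ.⊔ MN , λ m n p q → let open ℚ.≤-Reasoning in begin
      ∣ s m * t m - s n * t n ∣                        ≤⟨ ∣ab-cd∣ (s m) (t m) (s n) (t n) ⟩
      ∣ s m ∣ * ∣ t m - t n ∣ + ∣ t n ∣ * ∣ s m - s n ∣  ≤⟨ ℚ.+-mono-≤
        (mul-mono (ℚ.0≤∣p∣ (t m - t n)) 0≤B (b m (k p)) (g m n (v p) (v q)))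
        (mul-mono (ℚ.0≤∣p∣ (s m - s n)) 0≤C (c n (l q)) (f m n (u p) (u q))) ⟩
      B * δ + C * δ                                    ≡⟨ sym (ℚ.*-distribʳ-+ δ B C) ⟩
      (B + C) * δ                                      ∎

  ⊔-pos : ∀ d → 0ℚ < d → ∀ q → 0ℚ < q ℚ.⊔ d
  ⊔-pos d 0<d q = ℚ.<-≤-trans 0<d (ℚ.p≤q⊔p q d)

  inverse-cauchy : ∀ s d (0<d : 0ℚ < d) → IsCauchy s → (∃ λ N → ∀ n → N ℕ.≤ n → d ≤ s n) →
                   IsCauchy (λ n → inverse (s n ℚ.⊔ d) (⊔-pos d 0<d (s n)))
  inverse-cauchy s d 0<d cs (K , low) =
    cauchy-scaled i (e * e) (*-nonneg 0≤e 0≤e) λ δ 0<δ →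
    let N , f = cs δ 0<δ
    in K ℕ.⊔ N , λ m n p q → let open ℚ.≤-Reasoning in begin
      ∣ i m - i n ∣                    ≡⟨ cong ∣_∣ (inverse-sub (u m) (u n) (u-pos m) (u-pos n)) ⟩
      ∣ (i m * i n) * (u n - u m) ∣    ≡⟨ ℚ.∣p*q∣≡∣p∣*∣q∣ (i m * i n) (u n - u m) ⟩
      ∣ i m * i n ∣ * ∣ u n - u m ∣    ≡⟨ cong₂ _*_ (ℚ.0≤p⇒∣p∣≡p (*-nonneg (0≤i m) (0≤i n)))
                                           (cong₂ (λ a b → ∣ a - b ∣) (u≡s n (ℕ.m⊔n≤o⇒m≤o K N q)) (u≡s m (ℕ.m⊔n≤o⇒m≤o K N p))) ⟩
      (i m * i n) * ∣ s n - s m ∣      ≤⟨ mul-mono (ℚ.0≤∣p∣ (s n - s m)) (*-nonneg 0≤e 0≤e)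
                                           (mul-mono (0≤i n) 0≤e (i≤e m) (i≤e n))
                                           (f n m (ℕ.m⊔n≤o⇒n≤o K N q) (ℕ.m⊔n≤o⇒n≤o K N p)) ⟩
      (e * e) * δ                      ∎
    where
    e = inverse d 0<d
    0≤e = ℚ.<⇒≤ (inverse-pos d 0<d)
    u = λ n → s n ℚ.⊔ d
    u-pos = λ n → ⊔-pos d 0<d (s n)
    i = λ n → inverse (u n) (u-pos n)
    0≤i = λ n → ℚ.<⇒≤ (inverse-pos (u n) (u-pos n))
    i≤e : ∀ n → i n ≤ e
    i≤e n = inverse-anti d (u n) 0<d (u-pos n) (ℚ.p≤q⊔p (s n) d)
    u≡s : ∀ n → K ℕ.≤ n → u n ≡ s n
    u≡s n K≤n = ℚ.p≥q⇒p⊔q≡p (low n K≤n)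

  -- expTerm t k = tᵏ / k!
  expTerm : ℚ → ℕ → ℚ
  expTerm t zero    = 1ℚ
  expTerm t (suc k) = expTerm t k ℚ.* (t ℚ.* ((+ 1) ℚ./ suc k))

  -- expSum t n = Σ_{k<n} tᵏ / k!
  expSum : ℚ → ℕ → ℚ
  expSum t zero    = 0ℚ
  expSum t (suc n) = expSum t n ℚ.+ expTerm t n

  r : ℕ → ℚ
  r k = (+ 1) ℚ./ suc k

  0<r : ∀ k → 0ℚ < r k
  0<r k = ℚ.positive⁻¹ (r k) {{ℚ.normalize-pos 1 (suc k)}}

  0≤r : ∀ k → 0ℚ ≤ r k
  0≤r k = ℚ.<⇒≤ (0<r k)

  r-suc : ∀ k → ℕtoℚ (suc k) * r k ≡ 1ℚ
  r-suc k = ℚ.toℚᵘ-injective (ℚᵘ.≃-trans (ℚ.toℚᵘ-homo-* (ℕtoℚ (suc k)) (r k))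
    (ℚᵘ.≃-trans (ℚᵘ.*-cong (ℚ.toℚᵘ-fromℚᵘ ((+ suc k) ℚᵘ./ 1)) (ℚ.toℚᵘ-fromℚᵘ ((+ 1) ℚᵘ./ suc k)))
      (ℚᵘ.*≡* (cong (λ z → (+ suc z)) (arith k)))))
    where
    import Data.Rational.Unnormalised.Base as ℚᵘ
    import Data.Rational.Unnormalised.Properties as ℚᵘ
    arith : ∀ k → (k ℕ.* 1) ℕ.* 1 ≡ (k ℕ.+ 0) ℕ.+ 0
    arith k = trans (ℕ.*-identityʳ (k ℕ.* 1)) (trans (ℕ.*-identityʳ k) (sym (trans (ℕ.+-identityʳ _) (ℕ.+-identityʳ k))))

  term-nonneg : ∀ C → 0ℚ ≤ C → ∀ k → 0ℚ ≤ expTerm C k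
  term-nonneg C 0≤C zero = 0≤1
  term-nonneg C 0≤C (suc k) = *-nonneg (term-nonneg C 0≤C k) (*-nonneg 0≤C (0≤r k))

  sum-nonneg : ∀ C → 0ℚ ≤ C → ∀ k → 0ℚ ≤ expSum C k
  sum-nonneg C 0≤C zero = ℚ.≤-refl
  sum-nonneg C 0≤C (suc k) = +-nonneg (sum-nonneg C 0≤C k) (term-nonneg C 0≤C k)

  term-abs : ∀ t B → ∣ t ∣ ≤ B → ∀ k → ∣ expTerm t k ∣ ≤ expTerm B k
  term-abs t B t≤B zero = ℚ.≤-refl
  term-abs t B t≤B (suc k) = begin
    ∣ expTerm t k * (t * r k) ∣          ≡⟨ ℚ.∣p*q∣≡∣p∣*∣q∣ (expTerm t k) (t * r k) ⟩
    ∣ expTerm t k ∣ * ∣ t * r k ∣        ≡⟨ cong (∣ expTerm t k ∣ *_) (trans (ℚ.∣p*q∣≡∣p∣*∣q∣ t (r k)) (cong (∣ t ∣ *_) (ℚ.0≤p⇒∣p∣≡p (0≤r k)))) ⟩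
    ∣ expTerm t k ∣ * (∣ t ∣ * r k)      ≤⟨ mul-mono (*-nonneg (ℚ.0≤∣p∣ t) (0≤r k)) (term-nonneg B 0≤B k)
                                              (term-abs t B t≤B k) (mulʳ (r k) (0≤r k) t≤B) ⟩
    expTerm B k * (B * r k)              ∎
    where
    open ℚ.≤-Reasoning
    0≤B = ℚ.≤-trans (ℚ.0≤∣p∣ t) t≤B

  term-mono : ∀ B C → 0ℚ ≤ B → B ≤ C → ∀ k → expTerm B k ≤ expTerm C k
  term-mono B C 0≤B B≤C k = subst (_≤ expTerm C k) (ℚ.0≤p⇒∣p∣≡p (term-nonneg B 0≤B k))
    (term-abs B C (subst (_≤ C) (sym (ℚ.0≤p⇒∣p∣≡p 0≤B)) B≤C) k)

  term-lip : ∀ s t B → ∣ s ∣ ≤ B → ∣ t ∣ ≤ B → ∀ k →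
             ∣ expTerm s k - expTerm t k ∣ ≤ expTerm (1ℚ + B) k * ∣ s - t ∣
  term-lip s t B s≤B t≤B zero = subst (0ℚ ≤_) (sym (ℚ.*-identityˡ _)) (ℚ.0≤∣p∣ (s - t))
  term-lip s t B s≤B t≤B (suc k) = begin
    ∣ S * (s * r k) - T * (t * r k) ∣     ≡⟨ cong ∣_∣ (solve 5 (λ S s T t r → S :* (s :* r) :- T :* (t :* r) := (S :* s :- T :* t) :* r) refl S s T t (r k)) ⟩
    ∣ (S * s - T * t) * r k ∣             ≡⟨ trans (ℚ.∣p*q∣≡∣p∣*∣q∣ (S * s - T * t) (r k)) (cong (∣ S * s - T * t ∣ *_) (ℚ.0≤p⇒∣p∣≡p (0≤r k))) ⟩
    ∣ S * s - T * t ∣ * r k               ≤⟨ mulʳ (r k) (0≤r k) (∣ab-cd∣ S s T t) ⟩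
    (∣ S ∣ * D + ∣ t ∣ * ∣ S - T ∣) * r k  ≤⟨ mulʳ (r k) (0≤r k) (ℚ.+-mono-≤
        (mulʳ D 0≤D (ℚ.≤-trans (term-abs s B s≤B k) (term-mono B (1ℚ + B) 0≤B B≤1+B k)))
        (mul-mono (ℚ.0≤∣p∣ (S - T)) 0≤B t≤B (term-lip s t B s≤B t≤B k))) ⟩
    (E * D + B * (E * D)) * r k           ≡⟨ cong (λ z → (z + B * (E * D)) * r k) (sym (ℚ.*-identityˡ (E * D))) ⟩
    (1ℚ * (E * D) + B * (E * D)) * r k    ≡⟨ solve 5 (λ o b e d r → (o :* (e :* d) :+ b :* (e :* d)) :* r := (e :* ((o :+ b) :* r)) :* d) refl 1ℚ B E D (r k) ⟩
    (E * ((1ℚ + B) * r k)) * D            ∎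
    where
    open ℚ.≤-Reasoning
    S = expTerm s k
    T = expTerm t k
    E = expTerm (1ℚ + B) k
    D = ∣ s - t ∣
    0≤D = ℚ.0≤∣p∣ (s - t)
    0≤B = ℚ.≤-trans (ℚ.0≤∣p∣ s) s≤B
    B≤1+B : B ≤ 1ℚ + B
    B≤1+B = subst (B ≤_) (ℚ.+-comm B 1ℚ) (x≤x+y B 0≤1)

  sum-lip : ∀ s t B → ∣ s ∣ ≤ B → ∣ t ∣ ≤ B → ∀ n →
            ∣ expSum s n - expSum t n ∣ ≤ expSum (1ℚ + B) n * ∣ s - t ∣
  sum-lip s t B s≤B t≤B zero = ℚ.≤-reflexive (sym (ℚ.*-zeroˡ ∣ s - t ∣))
  sum-lip s t B s≤B t≤B (suc n) = begin
    ∣ (expSum s n + expTerm s n) - (expSum t n + expTerm t n) ∣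
      ≡⟨ cong ∣_∣ (solve 4 (λ a b c d → (a :+ b) :- (c :+ d) := (a :- c) :+ (b :- d)) refl (expSum s n) (expTerm s n) (expSum t n) (expTerm t n)) ⟩
    ∣ (expSum s n - expSum t n) + (expTerm s n - expTerm t n) ∣
      ≤⟨ ℚ.∣p+q∣≤∣p∣+∣q∣ (expSum s n - expSum t n) (expTerm s n - expTerm t n) ⟩
    ∣ expSum s n - expSum t n ∣ + ∣ expTerm s n - expTerm t n ∣
      ≤⟨ ℚ.+-mono-≤ (sum-lip s t B s≤B t≤B n) (term-lip s t B s≤B t≤B n) ⟩
    expSum (1ℚ + B) n * ∣ s - t ∣ + expTerm (1ℚ + B) n * ∣ s - t ∣
      ≡⟨ sym (ℚ.*-distribʳ-+ ∣ s - t ∣ (expSum (1ℚ + B) n) (expTerm (1ℚ + B) n)) ⟩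
    (expSum (1ℚ + B) n + expTerm (1ℚ + B) n) * ∣ s - t ∣ ∎
    where open ℚ.≤-Reasoning

  sum-tail : ∀ t B → ∣ t ∣ ≤ B → ∀ n j →
             ∣ expSum t (j ℕ.+ n) - expSum t n ∣ ≤ expSum B (j ℕ.+ n) - expSum B n
  sum-tail t B t≤B n zero = ℚ.≤-reflexive (trans (∣a-a∣≡0 (expSum t n)) (sym (ℚ.+-inverseʳ (expSum B n))))
  sum-tail t B t≤B n (suc j) = begin
    ∣ (x + y) - z ∣                 ≡⟨ cong ∣_∣ (solve 3 (λ x y z → (x :+ y) :- z := (x :- z) :+ y) refl x y z) ⟩
    ∣ (x - z) + y ∣                 ≤⟨ ℚ.∣p+q∣≤∣p∣+∣q∣ (x - z) y ⟩
    ∣ x - z ∣ + ∣ y ∣               ≤⟨ ℚ.+-mono-≤ (sum-tail t B t≤B n j) (term-abs t B t≤B (j ℕ.+ n)) ⟩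
    (X - Z) + Y                     ≡⟨ solve 3 (λ x y z → (x :- z) :+ y := (x :+ y) :- z) refl X Y Z ⟩
    (X + Y) - Z                     ∎
    where
    open ℚ.≤-Reasoning
    x = expSum t (j ℕ.+ n)
    y = expTerm t (j ℕ.+ n)
    z = expSum t n
    X = expSum B (j ℕ.+ n)
    Y = expTerm B (j ℕ.+ n)
    Z = expSum B n

  -- For C ≥ 0 and K ≥ 2C the terms beyond the K-th at least halve at each step.
  module Tail (C : ℚ) (0≤C : 0ℚ ≤ C) (K : ℕ) (2C≤K : C + C ≤ ℕtoℚ K) where
    open ℚ.≤-Reasoning

    T : ℕ → ℚ
    T = expTerm C

    0≤T : ∀ k → 0ℚ ≤ T k
    0≤T = term-nonneg C 0≤C

    halve : ∀ k → K ℕ.≤ k → T (suc k) + T (suc k) ≤ T k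
    halve k K≤k = begin
      T k * (C * r k) + T k * (C * r k)  ≡⟨ solve 3 (λ t c r → t :* (c :* r) :+ t :* (c :* r) := t :* ((c :+ c) :* r)) refl (T k) C (r k) ⟩
      T k * ((C + C) * r k)              ≤⟨ mulˡ (T k) (0≤T k) (mulʳ (r k) (0≤r k)
                                              (ℚ.≤-trans 2C≤K (ℕtoℚ-mono (ℕ.m≤n⇒m≤1+n K≤k)))) ⟩
      T k * (ℕtoℚ (suc k) * r k)         ≡⟨ trans (cong (T k *_) (r-suc k)) (ℚ.*-identityʳ (T k)) ⟩
      T k                                ∎

    tail : ∀ n → K ℕ.≤ n → ∀ j → expSum C (j ℕ.+ n) + (T (j ℕ.+ n) + T (j ℕ.+ n)) ≤ expSum C n + (T n + T n)
    tail n K≤n zero = ℚ.≤-refl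
    tail n K≤n (suc j) = begin
      (S + T k) + (T (suc k) + T (suc k))  ≤⟨ ℚ.+-monoʳ-≤ (S + T k) (halve k (ℕ.≤-trans K≤n (ℕ.m≤n+m n j))) ⟩
      (S + T k) + T k                      ≡⟨ ℚ.+-assoc S (T k) (T k) ⟩
      S + (T k + T k)                      ≤⟨ tail n K≤n j ⟩
      expSum C n + (T n + T n)             ∎
      where
      k = j ℕ.+ n
      S = expSum C k

    tail′ : ∀ n → K ℕ.≤ n → ∀ j → expSum C (j ℕ.+ n) - expSum C n ≤ T n + T n
    tail′ n K≤n j = begin
      X - Z              ≤⟨ ℚ.+-monoˡ-≤ (- Z) (ℚ.≤-trans (x≤x+y X (+-nonneg (0≤T (j ℕ.+ n)) (0≤T (j ℕ.+ n)))) (tail n K≤n j)) ⟩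
      (Z + (T n + T n)) - Z ≡⟨ solve 2 (λ z t → (z :+ t) :- z := t) refl Z (T n + T n) ⟩
      T n + T n          ∎
      where
      X = expSum C (j ℕ.+ n)
      Z = expSum C n

    sum-bound : ∀ n → K ℕ.≤ n → expSum C n ≤ expSum C K + (T K + T K)
    sum-bound n K≤n = subst (λ m → expSum C m ≤ expSum C K + (T K + T K)) (ℕ.m∸n+n≡m K≤n)
      (ℚ.≤-trans (x≤x+y (expSum C k) (+-nonneg (0≤T k) (0≤T k))) (tail K ℕ.≤-refl (n ℕ.∸ K)))
      where
      k = n ℕ.∸ K ℕ.+ K

    decay : ∀ j → ℕtoℚ (suc j) * T (j ℕ.+ K) ≤ T K
    decay zero = ℚ.≤-reflexive (ℚ.*-identityˡ (T K))
    decay (suc j) = begin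
      ℕtoℚ (suc (suc j)) * U     ≤⟨ mulʳ U (0≤T (suc j ℕ.+ K)) le ⟩
      (N + N) * U                ≡⟨ solve 2 (λ n u → (n :+ n) :* u := n :* (u :+ u)) refl N U ⟩
      N * (U + U)                ≤⟨ mulˡ N (ℕtoℚ-nonneg (suc j)) (halve (j ℕ.+ K) (ℕ.m≤n+m K j)) ⟩
      N * T (j ℕ.+ K)            ≤⟨ decay j ⟩
      T K                        ∎
      where
      U = T (suc j ℕ.+ K)
      N = ℕtoℚ (suc j)
      le : ℕtoℚ (suc (suc j)) ≤ N + N
      le = subst (_≤ N + N) (sym (ℕtoℚ-suc (suc j))) (ℚ.+-monoˡ-≤ N (ℕtoℚ-mono {1} {suc j} (ℕ.s≤s ℕ.z≤n)))

    vanish : ∀ ε → 0ℚ < ε → ∃ λ N → K ℕ.≤ N × ∀ n → N ℕ.≤ n → T n ≤ ε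
    vanish ε 0<ε =
      let J , h = archimedean (T K * inverse ε 0<ε)
      in J ℕ.+ K , ℕ.m≤n+m K J , λ n p →
      let j = n ℕ.∸ K
          K≤n = ℕ.≤-trans (ℕ.m≤n+m K J) p
          J≤j = subst (ℕ._≤ j) (ℕ.m+n∸n≡m J K) (ℕ.∸-monoˡ-≤ K p)
          i = inverse ε 0<ε
          N = ℕtoℚ (suc j)
          0<N = ℚ.<-≤-trans 0<1 (ℕtoℚ-mono {1} {suc j} (ℕ.s≤s ℕ.z≤n))
          instance _ = ℚ.positive 0<N
      in ℚ.*-cancelˡ-≤-pos N (begin
        N * T n             ≡⟨ cong (λ m → N * T m) (sym (ℕ.m∸n+n≡m K≤n)) ⟩
        N * T (j ℕ.+ K)     ≤⟨ decay j ⟩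
        T K                 ≡⟨ trans (sym (ℚ.*-identityʳ (T K))) (cong (T K *_) (sym (*-inverse ε 0<ε))) ⟩
        T K * (ε * i)       ≡⟨ solve 3 (λ t e i → t :* (e :* i) := (t :* i) :* e) refl (T K) ε i ⟩
        (T K * i) * ε       ≤⟨ mulʳ ε (ℚ.<⇒≤ 0<ε) (ℚ.≤-trans h (ℕtoℚ-mono (ℕ.m≤n⇒m≤1+n J≤j))) ⟩
        N * ε               ∎)

  exp-cauchy : ∀ s → IsCauchy s → IsCauchy (λ n → expSum (s n) n)
  exp-cauchy s cs = cauchy-scaled e A 0≤A λ δ 0<δ →
    let M , f = cs δ 0<δ
        V , K≤V , g = vanish δ 0<δ
        N₁ = L ℕ.⊔ M
        N = N₁ ℕ.⊔ V
        step : ∀ j n → N ℕ.≤ n → ∣ e (j ℕ.+ n) - e n ∣ ≤ A * δ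
        step j n p =
          let n≤m = ℕ.m≤n+m n j
              p₁ = ℕ.m⊔n≤o⇒m≤o N₁ V p
              L≤n = ℕ.m⊔n≤o⇒m≤o L M p₁
              M≤n = ℕ.m⊔n≤o⇒n≤o L M p₁
              V≤n = ℕ.m⊔n≤o⇒n≤o N₁ V p
              K≤n = ℕ.≤-trans K≤V V≤n
              m = j ℕ.+ n
              bm = b m (ℕ.≤-trans L≤n n≤m)
              bn = b n L≤n
              open ℚ.≤-Reasoning
          in begin
            ∣ e m - e n ∣  ≤⟨ triangle (e m) (expSum (s m) n) (e n) ⟩
            ∣ e m - expSum (s m) n ∣ + ∣ expSum (s m) n - e n ∣
              ≤⟨ ℚ.+-mono-≤
                  (ℚ.≤-trans (sum-tail (s m) C (ℚ.≤-trans bm B≤C) n j) (ℚ.≤-trans (tail′ n K≤n j) (ℚ.+-mono-≤ (g n V≤n) (g n V≤n))))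
                  (ℚ.≤-trans (sum-lip (s m) (s n) B bm bn n)
                    (mul-mono (ℚ.0≤∣p∣ (s m - s n)) 0≤G (sum-bound n K≤n) (f m n (ℕ.≤-trans M≤n n≤m) M≤n))) ⟩
            (δ + δ) + G * δ  ≡⟨ cong (λ z → (z + z) + G * δ) (sym (ℚ.*-identityˡ δ)) ⟩
            (1ℚ * δ + 1ℚ * δ) + G * δ ≡⟨ solve 3 (λ o d g → (o :* d :+ o :* d) :+ g :* d := ((o :+ o) :+ g) :* d) refl 1ℚ δ G ⟩
            A * δ ∎
    in N , λ m n p q → sym-step (λ m n p n≤m → subst (λ k → ∣ e k - e n ∣ ≤ A * δ) (ℕ.m∸n+n≡m n≤m) (step (m ℕ.∸ n) n p)) m n p q
    where
    e : ℕ → ℚ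
    e n = expSum (s n) n
    bd = bounded s cs
    B = proj₁ bd
    0≤B = proj₁ (proj₂ bd)
    L = proj₁ (proj₂ (proj₂ bd))
    b = proj₂ (proj₂ (proj₂ bd))
    C = 1ℚ + B
    B≤C : B ≤ C
    B≤C = subst (B ≤_) (ℚ.+-comm B 1ℚ) (x≤x+y B 0≤1)
    0≤C = +-nonneg 0≤1 0≤B
    arch = archimedean (C + C)
    K = proj₁ arch
    open Tail C 0≤C K (proj₂ arch)
    G = expSum C K + (T K + T K)
    0≤G : 0ℚ ≤ G
    0≤G = +-nonneg (sum-nonneg C 0≤C K) (+-nonneg (0≤T K) (0≤T K))
    A = (1ℚ + 1ℚ) + G
    0≤A : 0ℚ ≤ A
    0≤A = +-nonneg (+-nonneg 0≤1 0≤1) 0≤G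
    sym-step : ∀ {N X} → (∀ m n → N ℕ.≤ n → n ℕ.≤ m → ∣ e m - e n ∣ ≤ X) →
               ∀ m n → N ℕ.≤ m → N ℕ.≤ n → ∣ e m - e n ∣ ≤ X
    sym-step {N} {X} h m n p q with ℕ.≤-total n m
    ... | inj₁ n≤m = h m n q n≤m
    ... | inj₂ m≤n = subst (_≤ X) (∣∣-swap (e n) (e m)) (h n m p m≤n)

open Sequences public using (IsCauchy; expTerm; expSum)
open Sequences
  using (inverse; ⊔-pos; const-cauchy; +-cauchy; neg-cauchy; *-cauchy; inverse-cauchy; exp-cauchy)

-- Real numbers are Cauchy sequences of rationals; their equality is _≃_.
record ℝ : Set where
  constructor mkℝ
  field
    seq    : ℕ → ℚ
    cauchy : IsCauchy seq

open ℝ public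

infix 4 _≃_ _≤_ _<_

_≃_ : ℝ → ℝ → Set
x ≃ y = ∀ ε → 0ℚ ℚ.< ε → ∃ λ N → ∀ n → N ℕ.≤ n → ∣ seq x n ℚ.- seq y n ∣ ℚ.≤ ε

_≤_ : ℝ → ℝ → Set
x ≤ y = ∀ ε → 0ℚ ℚ.< ε → ∃ λ N → ∀ n → N ℕ.≤ n → seq x n ℚ.≤ seq y n ℚ.+ ε

_<_ : ℝ → ℝ → Set
x < y = ∃ λ d → 0ℚ ℚ.< d × ∃ λ N → ∀ n → N ℕ.≤ n → seq x n ℚ.+ d ℚ.≤ seq y n

fromℚ : ℚ → ℝ
fromℚ q = mkℝ (λ _ → q) (const-cauchy q)

fromℕ : ℕ → ℝ
fromℕ n = fromℚ ((+ n) ℚ./ 1)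

0ℝ 1ℝ : ℝ
0ℝ = fromℕ 0
1ℝ = fromℕ 1

infixl 6 _+_ _-_
infixl 7 _*_
infix  8 -_

_+_ : ℝ → ℝ → ℝ
x + y = mkℝ (λ n → seq x n ℚ.+ seq y n) (+-cauchy (seq x) (seq y) (cauchy x) (cauchy y))

-_ : ℝ → ℝ
- x = mkℝ (λ n → ℚ.- seq x n) (neg-cauchy (seq x) (cauchy x))

_-_ : ℝ → ℝ → ℝ
x - y = x + (- y)

_*_ : ℝ → ℝ → ℝ
x * y = mkℝ (λ n → seq x n ℚ.* seq y n) (*-cauchy (seq x) (seq y) (cauchy x) (cauchy y))

-- Eventually seq x n ≥ d, so the maximum with d changes only finitely many
-- entries; it keeps every denominator nonzero.
recip : (x : ℝ) → 0ℝ < x → ℝ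
recip x (d , 0<d , N , low) =
  mkℝ (λ n → inverse (seq x n ℚ.⊔ d) (⊔-pos d 0<d (seq x n)))
      (inverse-cauchy (seq x) d 0<d (cauchy x)
        (N , λ n N≤n → subst (ℚ._≤ seq x n) (ℚ.+-identityˡ d) (low n N≤n)))

exp : ℝ → ℝ
exp x = mkℝ (λ n → expSum (seq x n) n) (exp-cauchy (seq x) (cauchy x))

-- ℓ is the natural logarithm of 2, so that exp (l * ℓ) is 2ˡ.
IsLog₂ : ℝ → ℝ → Set
IsLog₂ x l = ∃ λ ℓ → exp ℓ ≃ fromℕ 2 × exp (l * ℓ) ≃ x

sum : List ℝ → ℝ
sum = List.foldr _+_ 0ℝ

-- Elements are named by their position in the input.  An algorithm is a
-- finite adaptive strategy; the same pair may be compared again.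
data Algorithm (n : ℕ) : Set where
  output  : Fin n → Algorithm n
  -- continue with the first branch on the answer "i is smaller than j",
  -- with the second on "j is smaller than i"
  compare : (i j : Fin n) → i ≢ j → Algorithm n → Algorithm n → Algorithm n
  -- uniformly random choice among k + 1 continuations
  random  : (k : ℕ) → (Fin (suc k) → Algorithm n) → Algorithm n

-- Worst case over comparison outcomes and internal randomness.
queries : ∀ {n} → Algorithm n → ℕ
queries (output _)          = 0
queries (compare _ _ _ a b) = suc (queries a ℕ.⊔ queries b)
queries (random k f)        = List.foldr ℕ._⊔_ 0 (List.tabulate λ i → queries (f i))

-- The unknown total order: π ⟨$⟩ʳ i is the rank of the element at position i.
Order : ℕ → Set
Order = Permutation′

IsMinimum : ∀ {n} → Order n → Fin n → Set
IsMinimum π i = ∀ j → π ⟨$⟩ʳ i Fin.≤ π ⟨$⟩ʳ j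

isMinimum? : ∀ {n} (π : Order n) (i : Fin n) → Dec (IsMinimum π i)
isMinimum? π i = Fin.all? λ j → π ⟨$⟩ʳ i Fin.≤? π ⟨$⟩ʳ j

-- Each permutation of Fin n exactly once (up to pointwise equality): choose the
-- rank j of the first element, then a permutation for the remaining ones.
orders : ∀ n → List (Order n)
orders zero    = Perm.id ∷ []
orders (suc n) = concatMap (λ j → map (insert Fin.zero j) (orders n)) (allFin (suc n))

pCorrect pWrong : ℝ → ℝ
pCorrect γ = fromℚ ½ + fromℚ ½ * γ
pWrong   γ = fromℚ ½ - fromℚ ½ * γ

-- Probability that the output is the minimum, for a fixed input order.  Every
-- comparison, repeated or not, has fresh independent noise.
successOn : ∀ {n} → ℝ → Order n → Algorithm n → ℝ
successOn γ π (output i) = if does (isMinimum? π i) then 1ℝ else 0ℝ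
successOn γ π (compare i j _ a b) =
  if does (π ⟨$⟩ʳ i Fin.<? π ⟨$⟩ʳ j)
  then pCorrect γ * successOn γ π a + pWrong γ * successOn γ π b
  else pWrong γ * successOn γ π a + pCorrect γ * successOn γ π b
successOn γ π (random k f) =
  fromℚ ((+ 1) ℚ./ suc k) * sum (List.tabulate λ i → successOn γ π (f i))

-- The input order is uniform over the n! orders.
success : ∀ {n} → ℝ → Algorithm n → ℝ
success {n} γ a =
  fromℚ (((+ 1) ℚ./ (n !)) {{ℕ._!≢0 n}}) * sum (map (λ π → successOn γ π a) (orders n))

{-# OPTIONS --safe #-}
module Submission where

-- The algorithm is a knockout tournament whose i-th round decides each match by
-- the majority of 2 M i comparisons, with M of order c / γ².  The rounds halve the
-- number of players while the price of a match grows only linearly in i, so the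
-- total is at most 4 M n comparisons.  By a Chernoff bound the minimum loses its
-- match in round i with probability at most ηⁱ, where η = exp (- Ω (c)); the sum
-- of this geometric series is at most 2 η.
--
-- Evaluating the reals entry by entry turns every estimate into one over ℚ.  The
-- entries of γ may exceed 1, where the "probabilities" become negative; since the
-- success probability is a polynomial in γ, hence Lipschitz on bounded sets, the
-- entries may be clamped to 1.


open import Algebra.Bundles using (CommutativeRing)
open import Data.Bool.Base using (Bool; true; false; if_then_else_)
open import Data.Empty using (⊥-elim)
open import Data.Fin.Base as Fin using (Fin)
open import Data.Fin.Permutation using (_⟨$⟩ʳ_; _⟨$⟩ˡ_; inverseʳ; inverseˡ; insert)
import Data.Fin.Properties as Fin
open import Data.Integer.Base as ℤ using ()
open import Data.List.Base as List using (List; []; _∷_; map; concatMap; allFin; length; tabulate)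
open import Data.List.Membership.Propositional using (_∈_)
open import Data.List.Membership.Propositional.Properties using (∈-allFin)
import Data.List.Properties as List
open import Data.List.Relation.Unary.Any using (here; there)
open import Data.Nat.Base as ℕ using (ℕ; zero; suc; z≤n; s≤s; ⌊_/2⌋; ⌈_/2⌉)
import Data.Nat.Properties as ℕ
open import Data.Nat.Solver using () renaming (module +-*-Solver to ℕ-Solver)
open import Data.Product.Base using (_×_; _,_; ∃; proj₁; proj₂)
open import Data.Rational.Base as ℚ using (ℚ; 0ℚ; 1ℚ; ½; ∣_∣; _⊓_; _⊔_)
import Data.Rational.Properties as ℚ
open import Data.Rational.Solver using (module +-*-Solver)
open import Data.Sum.Base using (inj₁; inj₂)
open import Function.Base using (_∘_; case_of_)
open import Relation.Binary.PropositionalEquality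
open import Relation.Nullary using (yes; no; does)
open import Relation.Nullary.Decidable using (dec-true; dec-false)
open import Defs hiding (_+_; _-_; _*_; -_; _≤_; _<_; sum)

-- The constant 3 in the budget is exact, which dictates how `M` is built. It is a product `S * C`
-- with `2 C ≤ c` and `S γ² ≤ 3/2`, so that `4 M n ≤ 3 c n / γ²`. Taking `C` near `c / 2` rather
-- than near `c` leaves room for `S ≥ 1` even at `γ = 1`; a cap of `3/4` on `S γ²` would force
-- `S = 0` there. A match of `2 S` comparisons has an error bound of `10/13`, a constant below 1,
-- and the `C`-th power makes it exponentially small in `c`. The rate `1/80` is small enough to
-- absorb the factor 2 and the rounding of `c / 2`. Neither `S` nor `C` can be computed from a real
-- by taking a floor, since the order on Cauchy reals is undecidable. Both come from rational
-- approximations: `γ` up to a factor `11/10`, `c` up to an additive constant. The other obstacle is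
-- that `exp` evaluates the `n`-th partial sum at the `n`-th entry of its argument, so every
-- estimate on partial sums has to be uniform in the argument.

module FindMin where

  open import Algebra.Properties.CommutativeSemiring.Exp (CommutativeRing.commutativeSemiring ℚ.+-*-commutativeRing)
    using (_^_; ^-homo-*; ^-assocʳ; ^-distrib-*)
  open import Data.Rational.Base using (_+_; _*_; _-_; -_; _≤_; _<_; _/_)
  open Sequences
  open +-*-Solver using (solve; con; _:+_; _:*_; _:-_; :-_; _:=_)

  -- Inequalities, powers and division with remainder over ℚ.

  ≤⇒0≤ : ∀ {p q} → p ≤ q → 0ℚ ≤ q - p
  ≤⇒0≤ {p} {q} p≤q = subst (_≤ q - p) (ℚ.+-inverseʳ p) (ℚ.+-monoˡ-≤ (- p) p≤q)

  ≤-by-gap : ∀ {p q} e → 0ℚ ≤ e → e ≡ q - p → p ≤ q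
  ≤-by-gap {p} {q} e 0≤e e≡ = subst (p ≤_) (trans (cong (p +_) e≡) (solve 2 (λ p q → p :+ (q :- p) := q) refl p q)) (x≤x+y p 0≤e)

  p≤∣p∣ : ∀ p → p ≤ ∣ p ∣
  p≤∣p∣ p with ℚ.≤-total 0ℚ p
  ... | inj₁ 0≤p = ℚ.≤-reflexive (sym (ℚ.0≤p⇒∣p∣≡p 0≤p))
  ... | inj₂ p≤0 = ℚ.≤-trans p≤0 (ℚ.0≤∣p∣ p)

  ^-nonneg : ∀ {x} → 0ℚ ≤ x → ∀ n → 0ℚ ≤ x ^ n
  ^-nonneg 0≤x zero    = 0≤1
  ^-nonneg 0≤x (suc n) = *-nonneg 0≤x (^-nonneg 0≤x n)

  ^-pos : ∀ {x} → 0ℚ < x → ∀ n → 0ℚ < x ^ n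
  ^-pos 0<x zero    = 0<1
  ^-pos 0<x (suc n) = *-pos 0<x (^-pos 0<x n)

  ^-monoˡ-≤ : ∀ {x y} → 0ℚ ≤ x → x ≤ y → ∀ n → x ^ n ≤ y ^ n
  ^-monoˡ-≤ 0≤x x≤y zero    = ℚ.≤-refl
  ^-monoˡ-≤ 0≤x x≤y (suc n) =
    mul-mono (^-nonneg 0≤x n) (ℚ.≤-trans 0≤x x≤y) x≤y (^-monoˡ-≤ 0≤x x≤y n)

  ^-≤1 : ∀ {x} → 0ℚ ≤ x → x ≤ 1ℚ → ∀ n → x ^ n ≤ 1ℚ
  ^-≤1 0≤x x≤1 zero    = ℚ.≤-refl
  ^-≤1 0≤x x≤1 (suc n) = mul-mono (^-nonneg 0≤x n) 0≤1 x≤1 (^-≤1 0≤x x≤1 n)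

  ^-≥1 : ∀ {x} → 1ℚ ≤ x → ∀ n → 1ℚ ≤ x ^ n
  ^-≥1 1≤x zero    = ℚ.≤-refl
  ^-≥1 {x} 1≤x (suc n) = mul-mono 0≤1 (ℚ.≤-trans 0≤1 1≤x) 1≤x (^-≥1 1≤x n)

  ℕtoℚ-homo-+ : ∀ m n → ℕtoℚ (m ℕ.+ n) ≡ ℕtoℚ m + ℕtoℚ n
  ℕtoℚ-homo-+ zero    n = sym (ℚ.+-identityˡ (ℕtoℚ n))
  ℕtoℚ-homo-+ (suc m) n rewrite ℕtoℚ-suc (m ℕ.+ n) | ℕtoℚ-suc m | ℕtoℚ-homo-+ m n =
    sym (ℚ.+-assoc 1ℚ (ℕtoℚ m) (ℕtoℚ n))

  ℕtoℚ-homo-* : ∀ m n → ℕtoℚ (m ℕ.* n) ≡ ℕtoℚ m * ℕtoℚ n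
  ℕtoℚ-homo-* zero    n = sym (ℚ.*-zeroˡ (ℕtoℚ n))
  ℕtoℚ-homo-* (suc m) n rewrite ℕtoℚ-homo-+ n (m ℕ.* n) | ℕtoℚ-suc m | ℕtoℚ-homo-* m n =
    solve 2 (λ m n → n :+ m :* n := (con 1ℚ :+ m) :* n) refl (ℕtoℚ m) (ℕtoℚ n)

  -- The reciprocal form of Bernoulli's inequality, which bounds the power from above and avoids
  -- division. Passing from `m` to `suc m` lowers the left side by exactly `P (1 + M) x²`.
  bernoulli : ∀ {x} → 0ℚ ≤ x → x ≤ 1ℚ → ∀ m → (1ℚ - x) ^ m * (1ℚ + ℕtoℚ m * x) ≤ 1ℚ
  bernoulli {x} 0≤x x≤1 zero = ℚ.≤-reflexive (solve 1 (λ x → con 1ℚ :* (con 1ℚ :+ con 0ℚ :* x) := con 1ℚ) refl x)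
  bernoulli {x} 0≤x x≤1 (suc m) rewrite ℕtoℚ-suc m = ℚ.≤-trans
    (≤-by-gap (P * ((1ℚ + M) * (x * x)))
      (*-nonneg (^-nonneg (≤⇒0≤ x≤1) m) (*-nonneg (+-nonneg 0≤1 (ℕtoℚ-nonneg m)) (*-nonneg 0≤x 0≤x)))
      (solve 3 (λ P M x → P :* ((con 1ℚ :+ M) :* (x :* x)) :=
         P :* (con 1ℚ :+ M :* x) :- (con 1ℚ :- x) :* P :* (con 1ℚ :+ (con 1ℚ :+ M) :* x)) refl P M x))
    (bernoulli 0≤x x≤1 m)
    where
    P = (1ℚ - x) ^ m
    M = ℕtoℚ m

  quotient : ∀ {x y} → 0ℚ < x → 0ℚ ≤ y → ∃ λ q → ℕtoℚ q * x ≤ y × y < ℕtoℚ (suc q) * x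
  quotient {x} {y} 0<x 0≤y = search (proj₁ arch) (begin-strict
      y                      ≡⟨ trans (sym (ℚ.*-identityʳ y)) (cong (y *_) (sym (*-inverse x 0<x))) ⟩
      y * (x * i)            ≡⟨ solve 3 (λ x y i → y :* (x :* i) := (y :* i) :* x) refl x y i ⟩
      (y * i) * x            ≤⟨ mulʳ x (ℚ.<⇒≤ 0<x) (proj₂ arch) ⟩
      ℕtoℚ K * x             <⟨ subst (_< x + ℕtoℚ K * x) (ℚ.+-identityˡ _) (ℚ.+-monoˡ-< (ℕtoℚ K * x) 0<x) ⟩
      x + ℕtoℚ K * x         ≡⟨ solve 2 (λ x k → x :+ k :* x := (con 1ℚ :+ k) :* x) refl x (ℕtoℚ K) ⟩
      (1ℚ + ℕtoℚ K) * x      ≡⟨ cong (_* x) (sym (ℕtoℚ-suc K)) ⟩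
      ℕtoℚ (suc K) * x       ∎)
    where
    open ℚ.≤-Reasoning
    i = inverse x 0<x
    arch = archimedean (y * i)
    K = proj₁ arch
    search : ∀ K → y < ℕtoℚ (suc K) * x → ∃ λ q → ℕtoℚ q * x ≤ y × y < ℕtoℚ (suc q) * x
    search zero    y< = zero , subst (_≤ y) (sym (ℚ.*-zeroˡ x)) 0≤y , y<
    search (suc K) y< with ℕtoℚ (suc K) * x ℚ.≤? y
    ... | yes ≤y = suc K , ≤y , y<
    ... | no  ≰y = search K (ℚ.≰⇒> ≰y)

  -- Multiplicativity of exp, up to tails of the exponential series

  ∑ : (ℕ → ℚ) → ℕ → ℚ
  ∑ f zero    = 0ℚ
  ∑ f (suc n) = ∑ f n + f n

  anti : (ℕ → ℕ → ℚ) → ℕ → ℚ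
  anti f zero    = f 0 0
  anti f (suc k) = f 0 (suc k) + anti (λ i → f (suc i)) k

  -- The sum of f i j over i + j < n, by rows.
  tri : (ℕ → ℕ → ℚ) → ℕ → ℚ
  tri f zero    = 0ℚ
  tri f (suc n) = ∑ (f 0) (suc n) + tri (λ i → f (suc i)) n

  rect : (ℕ → ℕ → ℚ) → ℕ → ℕ → ℚ
  rect f zero    n = 0ℚ
  rect f (suc m) n = ∑ (f 0) n + rect (λ i → f (suc i)) m n

  tri-suc : ∀ f n → tri f (suc n) ≡ tri f n + anti f n
  tri-suc f zero    = solve 1 (λ a → con 0ℚ :+ a :+ con 0ℚ := con 0ℚ :+ a) refl (f 0 0)
  tri-suc f (suc n) = trans (cong (∑ (f 0) (suc (suc n)) +_) (tri-suc (λ i → f (suc i)) n))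
    (solve 4 (λ a b c d → (a :+ b) :+ (c :+ d) := (a :+ c) :+ (b :+ d)) refl
      (∑ (f 0) (suc n)) (f 0 (suc n)) (tri (λ i → f (suc i)) n) (anti (λ i → f (suc i)) n))

  anti-cong : ∀ {f g} → (∀ i j → f i j ≡ g i j) → ∀ k → anti f k ≡ anti g k
  anti-cong eq zero    = eq 0 0
  anti-cong eq (suc k) = cong₂ _+_ (eq 0 (suc k)) (anti-cong (λ i → eq (suc i)) k)

  anti-scale : ∀ a f k → anti (λ i j → a * f i j) k ≡ a * anti f k
  anti-scale a f zero    = refl
  anti-scale a f (suc k) = trans (cong (a * f 0 (suc k) +_) (anti-scale a (λ i → f (suc i)) k))
    (sym (ℚ.*-distribˡ-+ a (f 0 (suc k)) (anti (λ i → f (suc i)) k)))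

  anti-last : ∀ f k → anti f (suc k) ≡ anti (λ i j → f i (suc j)) k + f (suc k) 0
  anti-last f zero    = refl
  anti-last f (suc k) = trans (cong (f 0 (suc (suc k)) +_) (anti-last (λ i → f (suc i)) k))
    (sym (ℚ.+-assoc (f 0 (suc (suc k))) _ _))

  -- Along the antidiagonal `i + j = k` the weight `l + k` splits as `(l + i) + j`. The offset `l`
  -- is there for the induction: removing row 0 shifts `i` by one.
  anti-weight : ∀ f l k → ℕtoℚ (l ℕ.+ k) * anti f k ≡ anti (λ i j → ℕtoℚ (l ℕ.+ i) * f i j) k + anti (λ i j → ℕtoℚ j * f i j) k
  anti-weight f l zero = solve 2 (λ a b → a :* b := a :* b :+ con 0ℚ :* b) refl (ℕtoℚ (l ℕ.+ 0)) (f 0 0)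
  anti-weight f l (suc k) = begin
    L * (a + A)
      ≡⟨ ℚ.*-distribˡ-+ L a A ⟩
    L * a + L * A
      ≡⟨ cong₂ _+_
           (cong (_* a) (trans (ℕtoℚ-homo-+ l (suc k)) (cong (λ n → ℕtoℚ n + K) (sym (ℕ.+-identityʳ l)))))
           (trans (cong (λ n → ℕtoℚ n * A) (ℕ.+-suc l k)) (anti-weight (λ i → f (suc i)) (suc l) k)) ⟩
    (ℕtoℚ (l ℕ.+ 0) + K) * a + (B + C)
      ≡⟨ cong (λ z → (ℕtoℚ (l ℕ.+ 0) + K) * a + (z + C))
           (anti-cong (λ i j → cong (λ n → ℕtoℚ n * f (suc i) j) (sym (ℕ.+-suc l i))) k) ⟩
    (ℕtoℚ (l ℕ.+ 0) + K) * a + (B′ + C)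
      ≡⟨ solve 5 (λ l k a b c → (l :+ k) :* a :+ (b :+ c) := (l :* a :+ b) :+ (k :* a :+ c)) refl
           (ℕtoℚ (l ℕ.+ 0)) K a B′ C ⟩
    (ℕtoℚ (l ℕ.+ 0) * a + B′) + (K * a + C) ∎
    where
    open ≡-Reasoning
    L = ℕtoℚ (l ℕ.+ suc k)
    K = ℕtoℚ (suc k)
    a = f 0 (suc k)
    A = anti (λ i → f (suc i)) k
    B = anti (λ i j → ℕtoℚ (suc l ℕ.+ i) * f (suc i) j) k
    B′ = anti (λ i j → ℕtoℚ (l ℕ.+ suc i) * f (suc i) j) k
    C = anti (λ i j → ℕtoℚ j * f (suc i) j) k

  expTerm-suc : ∀ s k → ℕtoℚ (suc k) * expTerm s (suc k) ≡ s * expTerm s k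
  expTerm-suc s k = trans
    (solve 4 (λ n t s r → n :* (t :* (s :* r)) := (n :* r) :* (s :* t)) refl (ℕtoℚ (suc k)) (expTerm s k) s (r k))
    (trans (cong (_* (s * expTerm s k)) (r-suc k)) (ℚ.*-identityˡ _))

  grid : ℚ → ℚ → ℕ → ℕ → ℚ
  grid s t i j = expTerm s i * expTerm t j

  -- (k + 1) tₖ₊₁ = (s + t) tₖ characterises the terms of exp (s + t); weighting
  -- the antidiagonal by k + 1 = i + j gives the same recursion.
  binomial : ∀ s t k → expTerm (s + t) k ≡ anti (grid s t) k
  binomial s t zero    = refl
  binomial s t (suc k) = ℚ.≤-antisym (cancel (ℚ.≤-reflexive eq)) (cancel (ℚ.≤-reflexive (sym eq)))
    where
    open ≡-Reasoning
    K = ℕtoℚ (suc k)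
    cancel : ∀ {p q} → K * p ≤ K * q → p ≤ q
    cancel = ℚ.*-cancelˡ-≤-pos K {{ℚ.positive (ℚ.<-≤-trans 0<1 (ℕtoℚ-mono {1} {suc k} (s≤s z≤n)))}}
    f = grid s t
    A = anti f k
    left : anti (λ i j → ℕtoℚ i * f i j) (suc k) ≡ s * A
    left = begin
      0ℚ * f 0 (suc k) + anti (λ i j → ℕtoℚ (suc i) * f (suc i) j) k
        ≡⟨ cong (_+ anti (λ i j → ℕtoℚ (suc i) * f (suc i) j) k) (ℚ.*-zeroˡ (f 0 (suc k))) ⟩
      0ℚ + anti (λ i j → ℕtoℚ (suc i) * f (suc i) j) k
        ≡⟨ ℚ.+-identityˡ _ ⟩
      anti (λ i j → ℕtoℚ (suc i) * f (suc i) j) k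
        ≡⟨ anti-cong (λ i j → trans (sym (ℚ.*-assoc (ℕtoℚ (suc i)) (expTerm s (suc i)) (expTerm t j)))
             (trans (cong (_* expTerm t j) (expTerm-suc s i)) (ℚ.*-assoc s (expTerm s i) (expTerm t j)))) k ⟩
      anti (λ i j → s * f i j) k
        ≡⟨ anti-scale s f k ⟩
      s * A ∎
    right : anti (λ i j → ℕtoℚ j * f i j) (suc k) ≡ t * A
    right = begin
      anti (λ i j → ℕtoℚ j * f i j) (suc k)
        ≡⟨ anti-last (λ i j → ℕtoℚ j * f i j) k ⟩
      anti (λ i j → ℕtoℚ (suc j) * f i (suc j)) k + 0ℚ * f (suc k) 0
        ≡⟨ trans (cong (λ z → anti (λ i j → ℕtoℚ (suc j) * f i (suc j)) k + z) (ℚ.*-zeroˡ (f (suc k) 0))) (ℚ.+-identityʳ _) ⟩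
      anti (λ i j → ℕtoℚ (suc j) * f i (suc j)) k
        ≡⟨ anti-cong (λ i j → trans
             (solve 3 (λ n a b → n :* (a :* b) := a :* (n :* b)) refl (ℕtoℚ (suc j)) (expTerm s i) (expTerm t (suc j)))
             (trans (cong (expTerm s i *_) (expTerm-suc t j))
               (solve 3 (λ a t b → a :* (t :* b) := t :* (a :* b)) refl (expTerm s i) t (expTerm t j)))) k ⟩
      anti (λ i j → t * f i j) k
        ≡⟨ anti-scale t f k ⟩
      t * A ∎
    eq : K * expTerm (s + t) (suc k) ≡ K * anti f (suc k)
    eq = begin
      K * expTerm (s + t) (suc k)  ≡⟨ expTerm-suc (s + t) k ⟩
      (s + t) * expTerm (s + t) k  ≡⟨ cong ((s + t) *_) (binomial s t k) ⟩
      (s + t) * A                  ≡⟨ ℚ.*-distribʳ-+ A s t ⟩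
      s * A + t * A                ≡⟨ sym (cong₂ _+_ left right) ⟩
      anti (λ i j → ℕtoℚ i * f i j) (suc k) + anti (λ i j → ℕtoℚ j * f i j) (suc k)
                                   ≡⟨ sym (anti-weight f 0 (suc k)) ⟩
      K * anti f (suc k)           ∎

  expSum-tri : ∀ s t n → expSum (s + t) n ≡ tri (grid s t) n
  expSum-tri s t zero    = refl
  expSum-tri s t (suc n) = trans (cong₂ _+_ (expSum-tri s t n) (binomial s t n)) (sym (tri-suc (grid s t) n))

  expSum-∑ : ∀ t n → expSum t n ≡ ∑ (expTerm t) n
  expSum-∑ t zero    = refl
  expSum-∑ t (suc n) = cong (_+ expTerm t n) (expSum-∑ t n)

  ∑-scale : ∀ a f n → ∑ (λ k → a * f k) n ≡ a * ∑ f n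
  ∑-scale a f zero    = sym (ℚ.*-zeroʳ a)
  ∑-scale a f (suc n) = trans (cong (_+ a * f n) (∑-scale a f n)) (sym (ℚ.*-distribˡ-+ a (∑ f n) (f n)))

  ∑-head : ∀ f n → ∑ f (suc n) ≡ f 0 + ∑ (λ i → f (suc i)) n
  ∑-head f zero    = ℚ.+-comm 0ℚ (f 0)
  ∑-head f (suc n) = trans (cong (_+ f (suc n)) (∑-head f n)) (ℚ.+-assoc (f 0) _ _)

  rect-product : ∀ (a b : ℕ → ℚ) m n → rect (λ i j → a i * b j) m n ≡ ∑ a m * ∑ b n
  rect-product a b zero    n = sym (ℚ.*-zeroˡ (∑ b n))
  rect-product a b (suc m) n = begin
    ∑ (λ j → a 0 * b j) n + rect (λ i j → a (suc i) * b j) m n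
      ≡⟨ cong₂ _+_ (∑-scale (a 0) b n) (rect-product (λ i → a (suc i)) b m n) ⟩
    a 0 * ∑ b n + ∑ (λ i → a (suc i)) m * ∑ b n
      ≡⟨ sym (ℚ.*-distribʳ-+ (∑ b n) (a 0) _) ⟩
    (a 0 + ∑ (λ i → a (suc i)) m) * ∑ b n
      ≡⟨ cong (_* ∑ b n) (sym (∑-head a m)) ⟩
    ∑ a (suc m) * ∑ b n ∎
    where open ≡-Reasoning

  expSum-rect : ∀ s t n → expSum s n * expSum t n ≡ rect (grid s t) n n
  expSum-rect s t n = trans (cong₂ _*_ (expSum-∑ s n) (expSum-∑ t n)) (sym (rect-product (expTerm s) (expTerm t) n n))

  ∑-nonneg : ∀ {f} → (∀ i → 0ℚ ≤ f i) → ∀ n → 0ℚ ≤ ∑ f n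
  ∑-nonneg 0≤f zero    = ℚ.≤-refl
  ∑-nonneg 0≤f (suc n) = +-nonneg (∑-nonneg 0≤f n) (0≤f n)

  ∑-mono : ∀ {f} → (∀ i → 0ℚ ≤ f i) → ∀ j n → ∑ f n ≤ ∑ f (j ℕ.+ n)
  ∑-mono 0≤f zero    n = ℚ.≤-refl
  ∑-mono {f} 0≤f (suc j) n = ℚ.≤-trans (∑-mono 0≤f j n) (x≤x+y _ (0≤f (j ℕ.+ n)))

  ∑-tail : ∀ {f F} → (∀ i → ∣ f i ∣ ≤ F i) → ∀ j n → ∣ ∑ f (j ℕ.+ n) - ∑ f n ∣ ≤ ∑ F (j ℕ.+ n) - ∑ F n
  ∑-tail {f} {F} f≤F zero n = ℚ.≤-reflexive (trans (∣a-a∣≡0 (∑ f n)) (sym (ℚ.+-inverseʳ (∑ F n))))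
  ∑-tail {f} {F} f≤F (suc j) n = begin
    ∣ (x + y) - z ∣                 ≡⟨ cong ∣_∣ (solve 3 (λ x y z → (x :+ y) :- z := (x :- z) :+ y) refl x y z) ⟩
    ∣ (x - z) + y ∣                 ≤⟨ ℚ.∣p+q∣≤∣p∣+∣q∣ (x - z) y ⟩
    ∣ x - z ∣ + ∣ y ∣               ≤⟨ ℚ.+-mono-≤ (∑-tail f≤F j n) (f≤F (j ℕ.+ n)) ⟩
    (X - Z) + Y                     ≡⟨ solve 3 (λ x y z → (x :- z) :+ y := (x :+ y) :- z) refl X Y Z ⟩
    (X + Y) - Z                     ∎
    where
    open ℚ.≤-Reasoning
    x = ∑ f (j ℕ.+ n)
    y = f (j ℕ.+ n)
    z = ∑ f n
    X = ∑ F (j ℕ.+ n)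
    Y = F (j ℕ.+ n)
    Z = ∑ F n

  -- The `m` by `n` rectangle lies inside the triangle `i + j < m + n`, and the extra entries are
  -- nonnegative.
  rect≤tri : ∀ {F} → (∀ i j → 0ℚ ≤ F i j) → ∀ m n → rect F m n ≤ tri F (m ℕ.+ n)
  rect≤tri 0≤F zero    zero    = ℚ.≤-refl
  rect≤tri {F} 0≤F zero (suc n) = +-nonneg (∑-nonneg (0≤F 0) (suc n)) (rect≤tri (λ i → 0≤F (suc i)) zero n)
  rect≤tri 0≤F (suc m) n       = ℚ.+-mono-≤ (∑-mono (0≤F 0) (suc m) n) (rect≤tri (λ i → 0≤F (suc i)) m n)

  -- For `k ≤ m` and `k ≤ n` the triangle lies inside the rectangle, so both differences are sums
  -- over the same leftover cells, where `F` dominates `f`.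
  rect-tri : ∀ {f F} → (∀ i j → ∣ f i j ∣ ≤ F i j) → ∀ m n k → k ℕ.≤ m → k ℕ.≤ n →
             ∣ rect f m n - tri f k ∣ ≤ rect F m n - tri F k
  rect-tri f≤F zero n zero _ _ = ℚ.≤-refl
  rect-tri {f} {F} f≤F (suc m) n zero _ _ = begin
    ∣ (x + y) - 0ℚ ∣                ≡⟨ cong ∣_∣ (solve 2 (λ x y → (x :+ y) :- con 0ℚ := (x :- con 0ℚ) :+ (y :- con 0ℚ)) refl x y) ⟩
    ∣ (x - 0ℚ) + (y - 0ℚ) ∣         ≤⟨ ℚ.∣p+q∣≤∣p∣+∣q∣ (x - 0ℚ) (y - 0ℚ) ⟩
    ∣ x - 0ℚ ∣ + ∣ y - 0ℚ ∣         ≤⟨ ℚ.+-mono-≤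
                                         (subst (λ k → ∣ ∑ (f 0) k - 0ℚ ∣ ≤ ∑ (F 0) k - 0ℚ) (ℕ.+-identityʳ n) (∑-tail (f≤F 0) n 0))
                                         (rect-tri (λ i → f≤F (suc i)) m n zero z≤n z≤n) ⟩
    (X - 0ℚ) + (Y - 0ℚ)             ≡⟨ solve 2 (λ x y → (x :- con 0ℚ) :+ (y :- con 0ℚ) := (x :+ y) :- con 0ℚ) refl X Y ⟩
    (X + Y) - 0ℚ                    ∎
    where
    open ℚ.≤-Reasoning
    x = ∑ (f 0) n
    y = rect (λ i → f (suc i)) m n
    X = ∑ (F 0) n
    Y = rect (λ i → F (suc i)) m n
  rect-tri {f} {F} f≤F (suc m) n (suc k) (s≤s k≤m) k<n = begin
    ∣ (x + y) - (z + w) ∣           ≡⟨ cong ∣_∣ (solve 4 (λ x y z w → (x :+ y) :- (z :+ w) := (x :- z) :+ (y :- w)) refl x y z w) ⟩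
    ∣ (x - z) + (y - w) ∣           ≤⟨ ℚ.∣p+q∣≤∣p∣+∣q∣ (x - z) (y - w) ⟩
    ∣ x - z ∣ + ∣ y - w ∣           ≤⟨ ℚ.+-mono-≤
                                         (subst (λ n → ∣ ∑ (f 0) n - z ∣ ≤ ∑ (F 0) n - Z) (ℕ.m∸n+n≡m k<n)
                                           (∑-tail (f≤F 0) (n ℕ.∸ suc k) (suc k)))
                                         (rect-tri (λ i → f≤F (suc i)) m n k k≤m (ℕ.<⇒≤ k<n)) ⟩
    (X - Z) + (Y - W)               ≡⟨ solve 4 (λ x y z w → (x :- z) :+ (y :- w) := (x :+ y) :- (z :+ w)) refl X Y Z W ⟩
    (X + Y) - (Z + W)               ∎
    where
    open ℚ.≤-Reasoning
    x = ∑ (f 0) n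
    y = rect (λ i → f (suc i)) m n
    z = ∑ (f 0) (suc k)
    w = tri (λ i → f (suc i)) k
    X = ∑ (F 0) n
    Y = rect (λ i → F (suc i)) m n
    Z = ∑ (F 0) (suc k)
    W = tri (λ i → F (suc i)) k

  -- Cauchy product: the square and the triangle differ in cells with `i + j ≥ n`. After passing to
  -- the dominating terms, these cells lie in the triangle of size `n + n`, which leaves a piece of
  -- the series of `S + T`.
  expSum-*-≤ : ∀ {s t S T} → ∣ s ∣ ≤ S → ∣ t ∣ ≤ T → ∀ n →
           ∣ expSum s n * expSum t n - expSum (s + t) n ∣ ≤ expSum (S + T) (n ℕ.+ n) - expSum (S + T) n
  expSum-*-≤ {s} {t} {S} {T} s≤S t≤T n = begin
    ∣ expSum s n * expSum t n - expSum (s + t) n ∣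
      ≡⟨ cong₂ (λ a b → ∣ a - b ∣) (expSum-rect s t n) (expSum-tri s t n) ⟩
    ∣ rect (grid s t) n n - tri (grid s t) n ∣
      ≤⟨ rect-tri (λ i j → subst (_≤ grid S T i j) (sym (ℚ.∣p*q∣≡∣p∣*∣q∣ (expTerm s i) (expTerm t j)))
           (mul-mono (ℚ.0≤∣p∣ (expTerm t j)) (term-nonneg S 0≤S i) (term-abs s S s≤S i) (term-abs t T t≤T j)))
           n n n ℕ.≤-refl ℕ.≤-refl ⟩
    rect (grid S T) n n - tri (grid S T) n
      ≤⟨ ℚ.+-monoˡ-≤ (- tri (grid S T) n) (rect≤tri (λ i j → *-nonneg (term-nonneg S 0≤S i) (term-nonneg T 0≤T j)) n n) ⟩
    tri (grid S T) (n ℕ.+ n) - tri (grid S T) n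
      ≡⟨ cong₂ _-_ (sym (expSum-tri S T (n ℕ.+ n))) (sym (expSum-tri S T n)) ⟩
    expSum (S + T) (n ℕ.+ n) - expSum (S + T) n ∎
    where
    open ℚ.≤-Reasoning
    0≤S = ℚ.≤-trans (ℚ.0≤∣p∣ s) s≤S
    0≤T = ℚ.≤-trans (ℚ.0≤∣p∣ t) t≤T

  -- `N` depends only on the bounds `S` and `T`, so the estimate applies to arguments that change
  -- with `n`.
  expSum-*-lower : ∀ {S T} → 0ℚ ≤ S → 0ℚ ≤ T → ∀ ε → 0ℚ < ε → ∃ λ N → ∀ n → N ℕ.≤ n →
              ∀ s t → ∣ s ∣ ≤ S → ∣ t ∣ ≤ T → expSum s n * expSum t n ≤ expSum (s + t) n + (ε + ε)
  expSum-*-lower {S} {T} 0≤S 0≤T ε 0<ε =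
    let K , 2C≤K = archimedean ((S + T) + (S + T))
        open Tail (S + T) (+-nonneg 0≤S 0≤T) K 2C≤K using (vanish; tail′)
        N , K≤N , small = vanish ε 0<ε
    in N , λ n N≤n s t s≤S t≤T → let open ℚ.≤-Reasoning in begin
      expSum s n * expSum t n
        ≡⟨ solve 2 (λ a b → a := b :+ (a :- b)) refl (expSum s n * expSum t n) (expSum (s + t) n) ⟩
      expSum (s + t) n + (expSum s n * expSum t n - expSum (s + t) n)
        ≤⟨ ℚ.+-monoʳ-≤ (expSum (s + t) n) (ℚ.≤-trans (p≤∣p∣ _) (ℚ.≤-trans (expSum-*-≤ s≤S t≤T n)
             (ℚ.≤-trans (tail′ n (ℕ.≤-trans K≤N N≤n) n) (ℚ.+-mono-≤ (small n N≤n) (small n N≤n))))) ⟩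
      expSum (s + t) n + (ε + ε) ∎

  -- Lower bounds for exp on the negative axis

  -- Since `2 u ≤ 1`, the terms at least halve from the linear one on, so everything after the
  -- leading 1 is at most twice `u`.
  expSum-neg-small : ∀ u → 0ℚ ≤ u → u + u ≤ 1ℚ → ∀ n → 1 ℕ.≤ n → ∣ expSum (- u) n - 1ℚ ∣ ≤ u + u
  expSum-neg-small u 0≤u 2u≤1 (suc n) _ = subst (λ m → ∣ expSum (- u) m - 1ℚ ∣ ≤ u + u) (ℕ.+-comm n 1) (begin
    ∣ expSum (- u) (n ℕ.+ 1) - expSum (- u) 1 ∣  ≤⟨ sum-tail (- u) u (ℚ.≤-reflexive (trans (ℚ.∣-p∣≡∣p∣ u) (ℚ.0≤p⇒∣p∣≡p 0≤u))) 1 n ⟩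
    expSum u (n ℕ.+ 1) - expSum u 1              ≤⟨ tail′ 1 ℕ.≤-refl n ⟩
    1ℚ * (u * 1ℚ) + 1ℚ * (u * 1ℚ)                ≡⟨ solve 1 (λ u → con 1ℚ :* (u :* con 1ℚ) :+ con 1ℚ :* (u :* con 1ℚ) := u :+ u) refl u ⟩
    u + u                                        ∎)
    where
    open ℚ.≤-Reasoning
    open Tail u 0≤u 1 2u≤1 using (tail′)

  module _ {a : ℚ} (0≤a : 0ℚ ≤ a) (2a≤1 : a + a ≤ 1ℚ) where

    private
      b = 1ℚ - (a + a)
      0≤b = ≤⇒0≤ 2a≤1
      ¼ = ½ * ½

    module _ {u} (0≤u : 0ℚ ≤ u) (u≤a : u ≤ a) (n : ℕ) (1≤n : 1 ℕ.≤ n) where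

      private
        E = expSum (- u) n
        ∣E-1∣≤ : ∣ E - 1ℚ ∣ ≤ a + a
        ∣E-1∣≤ = ℚ.≤-trans (expSum-neg-small u 0≤u (ℚ.≤-trans (ℚ.+-mono-≤ u≤a u≤a) 2a≤1) n 1≤n) (ℚ.+-mono-≤ u≤a u≤a)

      expSum-neg-≥ : b ≤ E
      expSum-neg-≥ = ≤-by-gap ((a + a) - (1ℚ - E))
        (≤⇒0≤ (ℚ.≤-trans (p≤∣p∣ (1ℚ - E)) (subst (_≤ a + a) (∣∣-swap E 1ℚ) ∣E-1∣≤)))
        (solve 2 (λ a e → (a :+ a) :- (con 1ℚ :- e) := e :- (con 1ℚ :- (a :+ a))) refl a E)

      expSum-neg-≤ : E ≤ 1ℚ + 1ℚ
      expSum-neg-≤ = ≤-by-gap (1ℚ - (E - 1ℚ)) (≤⇒0≤ (ℚ.≤-trans (p≤∣p∣ (E - 1ℚ)) (ℚ.≤-trans ∣E-1∣≤ 2a≤1)))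
        (solve 1 (λ e → con 1ℚ :- (e :- con 1ℚ) := (con 1ℚ :+ con 1ℚ) :- e) refl E)

    -- Induction on `C` from `exp (- u) ≥ 1 - 2 a = b`, using the approximate product formula. `N`
    -- is uniform in `u`, and `1 ≤ N` is carried along because the empty partial sum is 0.
    expSum-neg-multiple : ∀ C ε → 0ℚ < ε → ∃ λ N → 1 ℕ.≤ N × ∀ n → N ℕ.≤ n → ∀ u → 0ℚ ≤ u → u ≤ a →
                          b ^ C ≤ expSum (- (ℕtoℚ C * u)) n + ε
    expSum-neg-multiple zero ε 0<ε = 1 , ℕ.≤-refl , λ n 1≤n u _ _ → begin
      1ℚ                            ≡⟨⟩
      1ℚ - (0ℚ + 0ℚ)                ≤⟨ lower n 1≤n ⟩
      expSum (- 0ℚ) n               ≡⟨ cong (λ z → expSum (- z) n) (sym (ℚ.*-zeroˡ u)) ⟩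
      expSum (- (0ℚ * u)) n         ≤⟨ x≤x+y _ (ℚ.<⇒≤ 0<ε) ⟩
      expSum (- (0ℚ * u)) n + ε     ∎
      where
      open ℚ.≤-Reasoning
      lower : ∀ n → 1 ℕ.≤ n → 1ℚ - (0ℚ + 0ℚ) ≤ expSum (- 0ℚ) n
      lower n 1≤n = ≤-by-gap (0ℚ - (1ℚ - expSum (- 0ℚ) n))
        (≤⇒0≤ (ℚ.≤-trans (p≤∣p∣ _) (subst (_≤ 0ℚ) (∣∣-swap (expSum (- 0ℚ) n) 1ℚ) (expSum-neg-small 0ℚ ℚ.≤-refl 0≤1 n 1≤n))))
        (solve 1 (λ e → con 0ℚ :- (con 1ℚ :- e) := e :- con 1ℚ) refl (expSum (- 0ℚ) n))
    expSum-neg-multiple (suc C) ε 0<ε =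
      -- The induction hypothesis is off by `δ`, which the factor `E ≤ 2` doubles; the product
      -- formula costs `2 δ` more.
      let δ = ε * ¼
          0<δ = *-pos 0<ε (ℚ.positive⁻¹ ¼)
          0≤δ = ℚ.<⇒≤ 0<δ
          N₁ , 1≤N₁ , f = expSum-neg-multiple C δ 0<δ
          N₂ , g = expSum-*-lower {a} {ℕtoℚ C * a} 0≤a (*-nonneg (ℕtoℚ-nonneg C) 0≤a) δ 0<δ
      in N₁ ℕ.⊔ N₂ , ℕ.≤-trans 1≤N₁ (ℕ.m≤m⊔n N₁ N₂) , λ n N≤n u 0≤u u≤a →
      let open ℚ.≤-Reasoning
          N₁≤n = ℕ.m⊔n≤o⇒m≤o N₁ N₂ N≤n
          1≤n = ℕ.≤-trans 1≤N₁ N₁≤n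
          E = expSum (- u) n
          F = expSum (- (ℕtoℚ C * u)) n
          b≤E = expSum-neg-≥ 0≤u u≤a n 1≤n
          0≤Cu = *-nonneg (ℕtoℚ-nonneg C) 0≤u
          ∣-∣≤ : ∀ {p q} → 0ℚ ≤ p → p ≤ q → ∣ - p ∣ ≤ q
          ∣-∣≤ {p} 0≤p p≤q = subst (_≤ _) (sym (trans (ℚ.∣-p∣≡∣p∣ p) (ℚ.0≤p⇒∣p∣≡p 0≤p))) p≤q
          G = expSum (- u + - (ℕtoℚ C * u)) n
      in begin
        b * b ^ C               ≤⟨ mul-mono (^-nonneg 0≤b C) (ℚ.≤-trans 0≤b b≤E) b≤E (f n N₁≤n u 0≤u u≤a) ⟩
        E * (F + δ)             ≡⟨ ℚ.*-distribˡ-+ E F δ ⟩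
        E * F + E * δ           ≤⟨ ℚ.+-mono-≤
                                     (g n (ℕ.m⊔n≤o⇒n≤o N₁ N₂ N≤n) (- u) (- (ℕtoℚ C * u))
                                       (∣-∣≤ 0≤u u≤a) (∣-∣≤ 0≤Cu (mulˡ (ℕtoℚ C) (ℕtoℚ-nonneg C) u≤a)))
                                     (mulʳ δ 0≤δ (expSum-neg-≤ 0≤u u≤a n 1≤n)) ⟩
        (G + (δ + δ)) + (1ℚ + 1ℚ) * δ
                                ≡⟨ solve 2 (λ g e → (g :+ (e :* con ¼ :+ e :* con ¼)) :+ (con 1ℚ :+ con 1ℚ) :* (e :* con ¼)
                                     := g :+ e) refl G ε ⟩
        G + ε                   ≡⟨ cong (λ z → expSum z n + ε)
                                     (trans (solve 2 (λ c u → (:- u) :+ (:- (c :* u)) := :- ((con 1ℚ :+ c) :* u)) refl (ℕtoℚ C) u)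
                                       (cong (λ z → - (z * u)) (sym (ℕtoℚ-suc C)))) ⟩
        expSum (- (ℕtoℚ (suc C) * u)) n + ε ∎

    -- Cut `t` into `suc C` equal parts, each of size at most `a`.
    expSum-neg-lower : ∀ C ε → 0ℚ < ε → ∃ λ N → ∀ n → N ℕ.≤ n → ∀ t → 0ℚ ≤ t → t ≤ ℕtoℚ (suc C) * a →
                       b ^ suc C ≤ expSum (- t) n + ε
    expSum-neg-lower C ε 0<ε =
      let N , _ , f = expSum-neg-multiple (suc C) ε 0<ε
      in N , λ n N≤n t 0≤t t≤ →
        subst (λ z → b ^ suc C ≤ expSum (- z) n + ε)
          (trans (solve 3 (λ c t r → c :* (t :* r) := (c :* r) :* t) refl (ℕtoℚ (suc C)) t (r C))
            (trans (cong (_* t) (r-suc C)) (ℚ.*-identityˡ t)))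
          (f n N≤n (t * r C) (*-nonneg 0≤t (0≤r C))
            (ℚ.≤-trans (mulʳ (r C) (0≤r C) t≤) (ℚ.≤-reflexive
              (trans (solve 3 (λ c a r → (c :* a) :* r := (c :* r) :* a) refl (ℕtoℚ (suc C)) a (r C))
                (trans (cong (_* a) (r-suc C)) (ℚ.*-identityˡ a))))))

  -- Success probabilities over ℚ

  sumℚ : List ℚ → ℚ
  sumℚ = List.foldr _+_ 0ℚ

  pAnswer : ℚ → Bool → ℚ
  pAnswer x b = if b then ½ + ½ * x else ½ - ½ * x

  pFirst : ∀ {n} → ℚ → Order n → Fin n → Fin n → ℚ
  pFirst x π i j = pAnswer x (does (π ⟨$⟩ʳ i Fin.<? π ⟨$⟩ʳ j))

  -- Writing the second weight as `1ℚ - pFirst` gives both truth values the same convex-combination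
  -- form, so that `mix-≥` covers them together.
  successOnℚ : ∀ {n} → ℚ → Order n → Algorithm n → ℚ
  successOnℚ x π (output i) = if does (isMinimum? π i) then 1ℚ else 0ℚ
  successOnℚ x π (compare i j _ A B) =
    pFirst x π i j * successOnℚ x π A + (1ℚ - pFirst x π i j) * successOnℚ x π B
  successOnℚ x π (random k A) = r k * sumℚ (tabulate λ i → successOnℚ x π (A i))

  1/!ℚ : ℕ → ℚ
  1/!ℚ n = (ℤ.+ 1 / (n ℕ.!)) {{ℕ._!≢0 n}}

  successℚ : ∀ {n} → ℚ → Algorithm n → ℚ
  successℚ {n} x A = 1/!ℚ n * sumℚ (map (λ π → successOnℚ x π A) (orders n))

  module _ (m : ℕ) where

    seq-sum-tabulate : ∀ {k} {f : Fin k → ℝ} {g : Fin k → ℚ} → (∀ i → seq (f i) m ≡ g i) →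
                       seq (Defs.sum (tabulate f)) m ≡ sumℚ (tabulate g)
    seq-sum-tabulate {zero}  eq = refl
    seq-sum-tabulate {suc k} eq = cong₂ _+_ (eq Fin.zero) (seq-sum-tabulate (eq ∘ Fin.suc))

    seq-sum-map : ∀ {a} {X : Set a} {f : X → ℝ} {g : X → ℚ} → (∀ x → seq (f x) m ≡ g x) →
                  ∀ xs → seq (Defs.sum (map f xs)) m ≡ sumℚ (map g xs)
    seq-sum-map eq []       = refl
    seq-sum-map eq (x ∷ xs) = cong₂ _+_ (eq x) (seq-sum-map eq xs)

    seq-if : ∀ b {X Y : ℝ} {x y : ℚ} → seq X m ≡ x → seq Y m ≡ y → seq (if b then X else Y) m ≡ (if b then x else y)
    seq-if true  X≡x Y≡y = X≡x
    seq-if false X≡x Y≡y = Y≡y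

  module _ (γ : ℝ) (m : ℕ) where

    seq-answer : ∀ b {X Y : ℝ} {x y : ℚ} → seq X m ≡ x → seq Y m ≡ y →
      seq (if b then Defs.pCorrect γ Defs.* X Defs.+ Defs.pWrong γ Defs.* Y else Defs.pWrong γ Defs.* X Defs.+ Defs.pCorrect γ Defs.* Y) m
      ≡ pAnswer (seq γ m) b * x + (1ℚ - pAnswer (seq γ m) b) * y
    seq-answer true  refl refl = cong (λ z → (½ + ½ * seq γ m) * _ + z * _)
      (solve 1 (λ x → con ½ :- con ½ :* x := con 1ℚ :- (con ½ :+ con ½ :* x)) refl (seq γ m))
    seq-answer false refl refl = cong (λ z → (½ - ½ * seq γ m) * _ + z * _)
      (solve 1 (λ x → con ½ :+ con ½ :* x := con 1ℚ :- (con ½ :- con ½ :* x)) refl (seq γ m))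

    seq-successOn : ∀ {n} (π : Order n) A → seq (successOn γ π A) m ≡ successOnℚ (seq γ m) π A
    seq-successOn π (output i)          = seq-if m (does (isMinimum? π i)) {Defs.1ℝ} {Defs.0ℝ} refl refl
    seq-successOn π (compare i j _ A B) =
      seq-answer (does (π ⟨$⟩ʳ i Fin.<? π ⟨$⟩ʳ j)) {successOn γ π A} {successOn γ π B} (seq-successOn π A) (seq-successOn π B)
    seq-successOn π (random k A)        = cong (r k *_)
      (seq-sum-tabulate m {f = λ i → successOn γ π (A i)} {λ i → successOnℚ (seq γ m) π (A i)}
        (λ i → seq-successOn π (A i)))

    seq-success : ∀ {n} (A : Algorithm n) → seq (success γ A) m ≡ successℚ (seq γ m) A
    seq-success {n} A = cong (1/!ℚ n *_) (seq-sum-map m (λ π → seq-successOn π A) (orders n))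

  length-orders : ∀ n → length (orders n) ≡ n ℕ.!
  length-orders zero    = refl
  length-orders (suc n) = trans (concatMap-length (allFin (suc n))) (cong (ℕ._* (n ℕ.!)) (List.length-tabulate {n = suc n} (λ i → i)))
    where
    concatMap-length : ∀ js → length (concatMap (λ j → map (insert Fin.zero j) (orders n)) js) ≡ length js ℕ.* (n ℕ.!)
    concatMap-length []       = refl
    concatMap-length (j ∷ js) = trans (List.length-++ (map (insert Fin.zero j) (orders n)))
      (cong₂ ℕ._+_ (trans (List.length-map _ (orders n)) (length-orders n)) (concatMap-length js))

  sumℚ-lower : ∀ {a} {X : Set a} {v : ℚ} {f : X → ℚ} → (∀ x → v ≤ f x) → ∀ xs → ℕtoℚ (length xs) * v ≤ sumℚ (map f xs)
  sumℚ-lower {v = v} v≤f []       = ℚ.≤-reflexive (ℚ.*-zeroˡ v)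
  sumℚ-lower {v = v} v≤f (x ∷ xs) = ℚ.≤-trans
    (ℚ.≤-reflexive (trans (cong (_* v) (ℕtoℚ-suc (length xs)))
      (solve 2 (λ l v → (con 1ℚ :+ l) :* v := v :+ l :* v) refl (ℕtoℚ (length xs)) v)))
    (ℚ.+-mono-≤ (v≤f x) (sumℚ-lower v≤f xs))

  reciprocal-* : ∀ k .{{_ : ℕ.NonZero k}} v → (ℤ.+ 1 / k) * (ℕtoℚ k * v) ≡ v
  reciprocal-* (suc k) v = trans (solve 3 (λ r k v → r :* (k :* v) := (k :* r) :* v) refl (r k) (ℕtoℚ (suc k)) v)
    (trans (cong (_* v) (r-suc k)) (ℚ.*-identityˡ v))

  reciprocal-nonneg : ∀ k .{{_ : ℕ.NonZero k}} → 0ℚ ≤ ℤ.+ 1 / k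
  reciprocal-nonneg (suc k) = 0≤r k

  successℚ-lower : ∀ {n x v} (A : Algorithm n) → (∀ π → v ≤ successOnℚ x π A) → v ≤ successℚ x A
  successℚ-lower {n} {x} {v} A v≤ = begin
    v                                       ≡⟨ sym (reciprocal-* (n ℕ.!) {{ℕ._!≢0 n}} v) ⟩
    1/!ℚ n * (ℕtoℚ (n ℕ.!) * v)             ≡⟨ cong (λ l → 1/!ℚ n * (ℕtoℚ l * v)) (sym (length-orders n)) ⟩
    1/!ℚ n * (ℕtoℚ (length (orders n)) * v) ≤⟨ mulˡ (1/!ℚ n) (reciprocal-nonneg (n ℕ.!) {{ℕ._!≢0 n}}) (sumℚ-lower v≤ (orders n)) ⟩
    successℚ x A                            ∎
    where open ℚ.≤-Reasoning

  -- The bound on values is part of the notion because closure under products needs it. The interval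
  -- from -2 to 2 contains the entries of `γ` from some index on, as well as their clamped values.
  IsLipschitz : (ℚ → ℚ) → Set
  IsLipschitz f = ∃ λ B → ∃ λ K → 0ℚ ≤ B × 0ℚ ≤ K × (∀ x → ∣ x ∣ ≤ 1ℚ + 1ℚ → ∣ f x ∣ ≤ B) ×
    (∀ x y → ∣ x ∣ ≤ 1ℚ + 1ℚ → ∣ y ∣ ≤ 1ℚ + 1ℚ → ∣ f x - f y ∣ ≤ K * ∣ x - y ∣)

  const-lipschitz : ∀ q → IsLipschitz (λ _ → q)
  const-lipschitz q = ∣ q ∣ , 0ℚ , ℚ.0≤∣p∣ q , ℚ.≤-refl , (λ _ _ → ℚ.≤-refl) ,
    λ x y _ _ → ℚ.≤-reflexive (trans (∣a-a∣≡0 q) (sym (ℚ.*-zeroˡ ∣ x - y ∣)))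

  id-lipschitz : IsLipschitz (λ x → x)
  id-lipschitz = 1ℚ + 1ℚ , 1ℚ , +-nonneg 0≤1 0≤1 , 0≤1 , (λ _ p → p) , λ x y _ _ → ℚ.≤-reflexive (sym (ℚ.*-identityˡ _))

  +-lipschitz : ∀ {f g} → IsLipschitz f → IsLipschitz g → IsLipschitz (λ x → f x + g x)
  +-lipschitz {f} {g} (B , K , 0≤B , 0≤K , f≤ , lf) (C , L , 0≤C , 0≤L , g≤ , lg) =
    B + C , K + L , +-nonneg 0≤B 0≤C , +-nonneg 0≤K 0≤L ,
    (λ x p → ℚ.≤-trans (ℚ.∣p+q∣≤∣p∣+∣q∣ (f x) (g x)) (ℚ.+-mono-≤ (f≤ x p) (g≤ x p))) ,
    λ x y p q → let open ℚ.≤-Reasoning in begin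
      ∣ (f x + g x) - (f y + g y) ∣
        ≡⟨ cong ∣_∣ (solve 4 (λ a b c d → (a :+ b) :- (c :+ d) := (a :- c) :+ (b :- d)) refl (f x) (g x) (f y) (g y)) ⟩
      ∣ (f x - f y) + (g x - g y) ∣      ≤⟨ ℚ.∣p+q∣≤∣p∣+∣q∣ (f x - f y) (g x - g y) ⟩
      ∣ f x - f y ∣ + ∣ g x - g y ∣      ≤⟨ ℚ.+-mono-≤ (lf x y p q) (lg x y p q) ⟩
      K * ∣ x - y ∣ + L * ∣ x - y ∣      ≡⟨ sym (ℚ.*-distribʳ-+ ∣ x - y ∣ K L) ⟩
      (K + L) * ∣ x - y ∣                ∎

  *-lipschitz : ∀ {f g} → IsLipschitz f → IsLipschitz g → IsLipschitz (λ x → f x * g x)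
  *-lipschitz {f} {g} (B , K , 0≤B , 0≤K , f≤ , lf) (C , L , 0≤C , 0≤L , g≤ , lg) =
    B * C , B * L + C * K , *-nonneg 0≤B 0≤C , +-nonneg (*-nonneg 0≤B 0≤L) (*-nonneg 0≤C 0≤K) ,
    (λ x p → subst (_≤ B * C) (sym (ℚ.∣p*q∣≡∣p∣*∣q∣ (f x) (g x))) (mul-mono (ℚ.0≤∣p∣ (g x)) 0≤B (f≤ x p) (g≤ x p))) ,
    λ x y p q → let open ℚ.≤-Reasoning in begin
      ∣ f x * g x - f y * g y ∣                          ≤⟨ ∣ab-cd∣ (f x) (g x) (f y) (g y) ⟩
      ∣ f x ∣ * ∣ g x - g y ∣ + ∣ g y ∣ * ∣ f x - f y ∣  ≤⟨ ℚ.+-mono-≤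
        (mul-mono (ℚ.0≤∣p∣ (g x - g y)) 0≤B (f≤ x p) (lg x y p q))
        (mul-mono (ℚ.0≤∣p∣ (f x - f y)) 0≤C (g≤ y q) (lf x y p q)) ⟩
      B * (L * ∣ x - y ∣) + C * (K * ∣ x - y ∣)
        ≡⟨ solve 5 (λ b l c k d → b :* (l :* d) :+ c :* (k :* d) := (b :* l :+ c :* k) :* d) refl B L C K ∣ x - y ∣ ⟩
      (B * L + C * K) * ∣ x - y ∣                        ∎

  neg-lipschitz : ∀ {f} → IsLipschitz f → IsLipschitz (λ x → - f x)
  neg-lipschitz {f} (B , K , 0≤B , 0≤K , f≤ , lf) = B , K , 0≤B , 0≤K ,
    (λ x p → subst (_≤ B) (sym (ℚ.∣-p∣≡∣p∣ (f x))) (f≤ x p)) ,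
    λ x y p q → subst (_≤ K * ∣ x - y ∣)
      (trans (sym (ℚ.∣-p∣≡∣p∣ (f x - f y))) (cong ∣_∣ (solve 2 (λ a b → :- (a :- b) := (:- a) :- (:- b)) refl (f x) (f y))))
      (lf x y p q)

  sum-tabulate-lipschitz : ∀ k {f : Fin k → ℚ → ℚ} → (∀ i → IsLipschitz (f i)) → IsLipschitz (λ x → sumℚ (tabulate λ i → f i x))
  sum-tabulate-lipschitz zero    lf = const-lipschitz 0ℚ
  sum-tabulate-lipschitz (suc k) lf = +-lipschitz (lf Fin.zero) (sum-tabulate-lipschitz k (lf ∘ Fin.suc))

  sum-map-lipschitz : ∀ {a} {X : Set a} {f : X → ℚ → ℚ} → (∀ i → IsLipschitz (f i)) → ∀ is → IsLipschitz (λ x → sumℚ (map (λ i → f i x) is))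
  sum-map-lipschitz lf []       = const-lipschitz 0ℚ
  sum-map-lipschitz lf (i ∷ is) = +-lipschitz (lf i) (sum-map-lipschitz lf is)

  pAnswer-lipschitz : ∀ b → IsLipschitz (λ x → pAnswer x b)
  pAnswer-lipschitz true  = +-lipschitz (const-lipschitz ½) (*-lipschitz (const-lipschitz ½) id-lipschitz)
  pAnswer-lipschitz false = +-lipschitz (const-lipschitz ½) (neg-lipschitz (*-lipschitz (const-lipschitz ½) id-lipschitz))

  pFirst-lipschitz : ∀ {n} (π : Order n) i j → IsLipschitz (λ x → pFirst x π i j)
  pFirst-lipschitz π i j = pAnswer-lipschitz (does (π ⟨$⟩ʳ i Fin.<? π ⟨$⟩ʳ j))

  successOnℚ-lipschitz : ∀ {n} (π : Order n) A → IsLipschitz (λ x → successOnℚ x π A)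
  successOnℚ-lipschitz π (output i)          = const-lipschitz _
  successOnℚ-lipschitz π (compare i j _ A B) = +-lipschitz
    (*-lipschitz (pFirst-lipschitz π i j) (successOnℚ-lipschitz π A))
    (*-lipschitz (+-lipschitz (const-lipschitz 1ℚ) (neg-lipschitz (pFirst-lipschitz π i j))) (successOnℚ-lipschitz π B))
  successOnℚ-lipschitz π (random k A)        =
    *-lipschitz (const-lipschitz (r k)) (sum-tabulate-lipschitz (suc k) (λ i → successOnℚ-lipschitz π (A i)))

  successℚ-lipschitz : ∀ {n} (A : Algorithm n) → IsLipschitz (λ x → successℚ x A)
  successℚ-lipschitz {n} A = *-lipschitz (const-lipschitz (1/!ℚ n)) (sum-map-lipschitz (λ π → successOnℚ-lipschitz π A) (orders n))

  -- The tournament and its cost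

  module _ {n : ℕ} where

    -- a and b count the answers in favour of i and of j so far; ties go to j.
    vote : (i j : Fin n) → i ≢ j → (m a b : ℕ) → Algorithm n → Algorithm n → Algorithm n
    vote i j i≢j zero a b A B with b ℕ.<? a
    ... | yes _ = A
    ... | no  _ = B
    vote i j i≢j (suc m) a b A B = compare i j i≢j (vote i j i≢j m (suc a) b A B) (vote i j i≢j m a (suc b) A B)

    -- The continuation `κ` is what happens after the winner is known. Equal players are passed
    -- through, since `compare` demands distinct ones; this spares an invariant that the list of
    -- players has no repetitions.
    match : ℕ → (i j : Fin n) → (Fin n → Algorithm n) → Algorithm n
    match k i j κ with i Fin.≟ j
    ... | yes _   = κ i
    ... | no  i≢j = vote i j i≢j (k ℕ.+ k) 0 0 (κ i) (κ j)

    -- An unpaired last player advances without a match.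
    round : ℕ → List (Fin n) → (List (Fin n) → Algorithm n) → Algorithm n
    round k []           κ = κ []
    round k (x ∷ [])     κ = κ (x ∷ [])
    round k (x ∷ y ∷ xs) κ = match k x y λ w → round k xs λ ws → κ (w ∷ ws)

    -- d is a junk output for the empty list; length xs rounds of fuel always suffice.
    tournament : (M fuel i : ℕ) → Fin n → List (Fin n) → Algorithm n
    tournament M f       i d []               = output d
    tournament M f       i d (x ∷ [])         = output x
    tournament M zero    i d (x ∷ _ ∷ _)      = output x
    tournament M (suc f) i d xs@(_ ∷ _ ∷ _) = round (M ℕ.* i) xs (tournament M f (suc i) d)

    vote-queries : ∀ i j i≢j m a b {A B q} → queries A ℕ.≤ q → queries B ℕ.≤ q →
                   queries (vote i j i≢j m a b A B) ℕ.≤ m ℕ.+ q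
    vote-queries i j i≢j zero a b A≤q B≤q with b ℕ.<? a
    ... | yes _ = A≤q
    ... | no  _ = B≤q
    vote-queries i j i≢j (suc m) a b A≤q B≤q =
      s≤s (ℕ.⊔-lub (vote-queries i j i≢j m (suc a) b A≤q B≤q) (vote-queries i j i≢j m a (suc b) A≤q B≤q))

    match-queries : ∀ k i j {κ q} → (∀ w → queries (κ w) ℕ.≤ q) → queries (match k i j κ) ℕ.≤ (k ℕ.+ k) ℕ.+ q
    match-queries k i j {q = q} κ≤q with i Fin.≟ j
    ... | yes _   = ℕ.≤-trans (κ≤q i) (ℕ.m≤n+m q (k ℕ.+ k))
    ... | no  i≢j = vote-queries i j i≢j (k ℕ.+ k) 0 0 (κ≤q i) (κ≤q j)

    round-queries : ∀ k xs {κ q} → (∀ ws → length ws ≡ ⌈ length xs /2⌉ → queries (κ ws) ℕ.≤ q) →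
                    queries (round k xs κ) ℕ.≤ ⌊ length xs /2⌋ ℕ.* (k ℕ.+ k) ℕ.+ q
    round-queries k []           κ≤q = κ≤q [] refl
    round-queries k (x ∷ [])     κ≤q = κ≤q (x ∷ []) refl
    round-queries k (x ∷ y ∷ xs) {q = q} κ≤q = ℕ.≤-trans
      (match-queries k x y λ w → round-queries k xs λ ws eq → κ≤q (w ∷ ws) (cong suc eq))
      (ℕ.≤-reflexive (sym (ℕ.+-assoc (k ℕ.+ k) (⌊ length xs /2⌋ ℕ.* (k ℕ.+ k)) q)))

    -- With `l` players left, the induction reduces to `⌊l/2⌋ i + (⌈l/2⌉ - 1) (i + 2) ≤ (l - 1) (i +
    -- 1)`, that is, to `2 ⌈l/2⌉ ≤ l + 1`. Counting `l - 1` instead of `l` is what absorbs the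
    -- player who advances unpaired when `l` is odd.
    tournament-queries : ∀ M f i d xs → queries (tournament M f i d xs) ℕ.≤ (M ℕ.+ M) ℕ.* (ℕ.pred (length xs) ℕ.* suc i)
    tournament-queries M f       i d []               = z≤n
    tournament-queries M f       i d (x ∷ [])         = z≤n
    tournament-queries M zero    i d (x ∷ _ ∷ _)      = z≤n
    tournament-queries M (suc f) i d xs@(_ ∷ _ ∷ ys) = ℕ.≤-trans
      (round-queries (M ℕ.* i) xs {tournament M f (suc i) d} λ ws eq →
        subst (λ l → queries (tournament M f (suc i) d ws) ℕ.≤ (M ℕ.+ M) ℕ.* (ℕ.pred l ℕ.* suc (suc i))) eq
        (tournament-queries M f (suc i) d ws))
      (begin
        suc a ℕ.* (M ℕ.* i ℕ.+ M ℕ.* i) ℕ.+ (M ℕ.+ M) ℕ.* (b ℕ.* suc (suc i))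
          ≡⟨ ℕ-Solver.solve 4 (λ a b M i → (nat 1 ⊕ a) ⊗ (M ⊗ i ⊕ M ⊗ i) ⊕ (M ⊕ M) ⊗ (b ⊗ (nat 2 ⊕ i))
               ≐ (M ⊕ M) ⊗ ((a ⊕ b) ⊗ i ⊕ i ⊕ b ⊕ b)) refl a b M i ⟩
        (M ℕ.+ M) ℕ.* ((a ℕ.+ b) ℕ.* i ℕ.+ i ℕ.+ b ℕ.+ b)
          ≤⟨ ℕ.*-monoʳ-≤ (M ℕ.+ M) (ℕ.+-monoʳ-≤ ((a ℕ.+ b) ℕ.* i ℕ.+ i ℕ.+ b) (ℕ.⌊n/2⌋-mono (ℕ.n≤1+n (suc (length ys))))) ⟩
        (M ℕ.+ M) ℕ.* ((a ℕ.+ b) ℕ.* i ℕ.+ i ℕ.+ b ℕ.+ suc a)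
          ≡⟨ ℕ-Solver.solve 4 (λ a b M i → (M ⊕ M) ⊗ ((a ⊕ b) ⊗ i ⊕ i ⊕ b ⊕ (nat 1 ⊕ a))
               ≐ (M ⊕ M) ⊗ ((nat 1 ⊕ (a ⊕ b)) ⊗ (nat 1 ⊕ i))) refl a b M i ⟩
        (M ℕ.+ M) ℕ.* (suc (a ℕ.+ b) ℕ.* suc i)
          ≡⟨ cong (λ l → (M ℕ.+ M) ℕ.* (suc l ℕ.* suc i)) (ℕ.⌊n/2⌋+⌈n/2⌉≡n (length ys)) ⟩
        (M ℕ.+ M) ℕ.* (suc (length ys) ℕ.* suc i) ∎)
      where
      open ℕ.≤-Reasoning
      open ℕ-Solver using () renaming (con to nat; _:+_ to _⊕_; _:*_ to _⊗_; _:=_ to _≐_)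
      a = ⌊ length ys /2⌋
      b = ⌈ length ys /2⌉

  -- Success probability of votes, matches and rounds

  0≤½ : 0ℚ ≤ ½
  0≤½ = ℚ.≤ᵇ⇒≤ _

  pAnswer-bounds : ∀ {x} → 0ℚ ≤ x → x ≤ 1ℚ → ∀ b → 0ℚ ≤ pAnswer x b × pAnswer x b ≤ 1ℚ
  pAnswer-bounds {x} 0≤x x≤1 true =
    +-nonneg 0≤½ (*-nonneg 0≤½ 0≤x) ,
    ≤-by-gap (½ * (1ℚ - x)) (*-nonneg 0≤½ (≤⇒0≤ x≤1))
      (solve 1 (λ x → con ½ :* (con 1ℚ :- x) := con 1ℚ :- (con ½ :+ con ½ :* x)) refl x)
  pAnswer-bounds {x} 0≤x x≤1 false =
    ≤-by-gap (½ * (1ℚ - x)) (*-nonneg 0≤½ (≤⇒0≤ x≤1))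
      (solve 1 (λ x → con ½ :* (con 1ℚ :- x) := con ½ :- con ½ :* x :- con 0ℚ) refl x) ,
    ≤-by-gap (½ * (1ℚ + x)) (*-nonneg 0≤½ (+-nonneg 0≤1 0≤x))
      (solve 1 (λ x → con ½ :* (con 1ℚ :+ x) := con 1ℚ :- (con ½ :- con ½ :* x)) refl x)

  mix-≥ : ∀ {p v s t} → 0ℚ ≤ p → p ≤ 1ℚ → v ≤ s → v ≤ t → v ≤ p * s + (1ℚ - p) * t
  mix-≥ {p} {v} {s} {t} 0≤p p≤1 v≤s v≤t = ≤-by-gap (p * (s - v) + (1ℚ - p) * (t - v))
    (+-nonneg (*-nonneg 0≤p (≤⇒0≤ v≤s)) (*-nonneg (≤⇒0≤ p≤1) (≤⇒0≤ v≤t)))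
    (solve 4 (λ p v s t → p :* (s :- v) :+ (con 1ℚ :- p) :* (t :- v) := (p :* s :+ (con 1ℚ :- p) :* t) :- v) refl p v s t)

  sum-tabulate-nonneg : ∀ {k} (f : Fin k → ℚ) → (∀ i → 0ℚ ≤ f i) → 0ℚ ≤ sumℚ (tabulate f)
  sum-tabulate-nonneg {zero}  f 0≤f = ℚ.≤-refl
  sum-tabulate-nonneg {suc k} f 0≤f = +-nonneg (0≤f Fin.zero) (sum-tabulate-nonneg (f ∘ Fin.suc) (0≤f ∘ Fin.suc))

  -- The Markov step of the Chernoff bound: when the vote is not won, the potential is at least
  -- `(x y) ^ k`, its value at a tie. Factor out `(x y) ^ a`; what remains is `y ^ (b ∸ a) ≥ 1`
  -- against `(x y) ^ (k ∸ a) ≤ 1`.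
  potential-≥ : ∀ {x y} → 0ℚ ≤ x → 1ℚ ≤ y → x * y ≤ 1ℚ → ∀ {a b} k → a ℕ.+ b ≡ k ℕ.+ k → a ℕ.≤ b →
                (x * y) ^ k ≤ x ^ a * y ^ b
  potential-≥ {x} {y} 0≤x 1≤y xy≤1 {a} {b} k a+b≡2k a≤b = begin
    u ^ k                        ≡⟨ cong (u ^_) (sym (ℕ.m+[n∸m]≡n a≤k)) ⟩
    u ^ (a ℕ.+ (k ℕ.∸ a))        ≡⟨ ^-homo-* u a (k ℕ.∸ a) ⟩
    u ^ a * u ^ (k ℕ.∸ a)        ≤⟨ mulˡ (u ^ a) (^-nonneg 0≤u a) (ℚ.≤-trans (^-≤1 0≤u xy≤1 (k ℕ.∸ a)) (^-≥1 1≤y (b ℕ.∸ a))) ⟩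
    u ^ a * y ^ (b ℕ.∸ a)        ≡⟨ cong (_* y ^ (b ℕ.∸ a)) (^-distrib-* x y a) ⟩
    x ^ a * y ^ a * y ^ (b ℕ.∸ a) ≡⟨ ℚ.*-assoc (x ^ a) (y ^ a) (y ^ (b ℕ.∸ a)) ⟩
    x ^ a * (y ^ a * y ^ (b ℕ.∸ a)) ≡⟨ cong (x ^ a *_) (sym (^-homo-* y a (b ℕ.∸ a))) ⟩
    x ^ a * y ^ (a ℕ.+ (b ℕ.∸ a)) ≡⟨ cong (λ c → x ^ a * y ^ c) (ℕ.m+[n∸m]≡n a≤b) ⟩
    x ^ a * y ^ b                ∎
    where
    open ℚ.≤-Reasoning
    u = x * y
    0≤u : 0ℚ ≤ u
    0≤u = *-nonneg 0≤x (ℚ.≤-trans 0≤1 1≤y)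
    a≤k : a ℕ.≤ k
    a≤k = ℕ.≮⇒≥ λ k<a → ℕ.<-irrefl (sym a+b≡2k) (ℕ.+-mono-<-≤ k<a (ℕ.≤-trans (ℕ.<⇒≤ k<a) a≤b))

  module _ {n : ℕ} (π : Order n) {γ : ℚ} (0≤γ : 0ℚ ≤ γ) (γ≤1 : γ ≤ 1ℚ) where

    private
      s : Algorithm n → ℚ
      s = successOnℚ γ π

    pFirst-≥0 : ∀ i j → 0ℚ ≤ pFirst γ π i j
    pFirst-≥0 i j = proj₁ (pAnswer-bounds 0≤γ γ≤1 (does (π ⟨$⟩ʳ i Fin.<? π ⟨$⟩ʳ j)))

    pFirst-≤1 : ∀ i j → pFirst γ π i j ≤ 1ℚ
    pFirst-≤1 i j = proj₂ (pAnswer-bounds 0≤γ γ≤1 (does (π ⟨$⟩ʳ i Fin.<? π ⟨$⟩ʳ j)))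

    successOnℚ-nonneg : ∀ A → 0ℚ ≤ s A
    successOnℚ-nonneg (output i) with does (isMinimum? π i)
    ... | true  = 0≤1
    ... | false = ℚ.≤-refl
    successOnℚ-nonneg (compare i j _ A B) = mix-≥ (pFirst-≥0 i j) (pFirst-≤1 i j) (successOnℚ-nonneg A) (successOnℚ-nonneg B)
    successOnℚ-nonneg (random k A) =
      *-nonneg (0≤r k) (sum-tabulate-nonneg (λ i → s (A i)) (λ i → successOnℚ-nonneg (A i)))

    vote-≥ : ∀ i j i≢j m a b {A B v} → v ≤ s A → v ≤ s B → v ≤ s (vote i j i≢j m a b A B)
    vote-≥ i j i≢j zero a b v≤A v≤B with b ℕ.<? a
    ... | yes _ = v≤A
    ... | no  _ = v≤B
    vote-≥ i j i≢j (suc m) a b v≤A v≤B = mix-≥ (pFirst-≥0 i j) (pFirst-≤1 i j)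
      (vote-≥ i j i≢j m (suc a) b v≤A v≤B) (vote-≥ i j i≢j m a (suc b) v≤A v≤B)

    match-≥ : ∀ k i j {κ v} → (∀ w → v ≤ s (κ w)) → v ≤ s (match k i j κ)
    match-≥ k i j v≤κ with i Fin.≟ j
    ... | yes _   = v≤κ i
    ... | no  i≢j = vote-≥ i j i≢j (k ℕ.+ k) 0 0 (v≤κ i) (v≤κ j)

    round-≥ : ∀ k xs {κ v} → (∀ ws → length ws ≡ ⌈ length xs /2⌉ → v ≤ s (κ ws)) → v ≤ s (round k xs κ)
    round-≥ k []           v≤κ = v≤κ [] refl
    round-≥ k (x ∷ [])     v≤κ = v≤κ (x ∷ []) refl
    round-≥ k (x ∷ y ∷ xs) v≤κ = match-≥ k x y λ w → round-≥ k xs λ ws eq → v≤κ (w ∷ ws) (cong suc eq)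

    -- x ^ a * y ^ b, weighting the votes, shrinks on average by the factor z at
    -- every comparison.
    vote-potential : ∀ i j i≢j {A B x y z v w} t → 0ℚ ≤ x → 0ℚ ≤ y → 0ℚ ≤ z → 0ℚ ≤ v →
      pFirst γ π i j * x + (1ℚ - pFirst γ π i j) * y ≤ z →
      (∀ a b → a ℕ.+ b ≡ t → v * w ≤ s (vote i j i≢j 0 a b A B) * w + v * (x ^ a * y ^ b)) →
      ∀ m a b → m ℕ.+ (a ℕ.+ b) ≡ t → v * w ≤ s (vote i j i≢j m a b A B) * w + v * (x ^ a * y ^ b * z ^ m)
    vote-potential i j i≢j {A} {B} {x} {y} {z} {v} {w} t 0≤x 0≤y 0≤z 0≤v mean base zero a b eq =
      subst (λ q → v * w ≤ s (vote i j i≢j 0 a b A B) * w + v * q) (sym (ℚ.*-identityʳ (x ^ a * y ^ b))) (base a b eq)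
    vote-potential i j i≢j {A} {B} {x} {y} {z} {v} {w} t 0≤x 0≤y 0≤z 0≤v mean base (suc m) a b eq =
      ≤-by-gap (p * (S₁ * w + v * (x * X * Y * Z) - v * w) + (1ℚ - p) * (S₂ * w + v * (X * (y * Y) * Z) - v * w)
                + v * (X * Y * Z) * (z - (p * x + (1ℚ - p) * y)))
        (+-nonneg (+-nonneg
          (*-nonneg (pFirst-≥0 i j) (≤⇒0≤ (rec m (suc a) b (trans (ℕ.+-suc m (a ℕ.+ b)) eq))))
          (*-nonneg (≤⇒0≤ (pFirst-≤1 i j)) (≤⇒0≤ (rec m a (suc b) (trans (cong (m ℕ.+_) (ℕ.+-suc a b)) (trans (ℕ.+-suc m (a ℕ.+ b)) eq))))))
          (*-nonneg (*-nonneg 0≤v (*-nonneg (*-nonneg (^-nonneg 0≤x a) (^-nonneg 0≤y b)) (^-nonneg 0≤z m))) (≤⇒0≤ mean)))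
        (solve 11 (λ p S₁ S₂ x y z v w X Y Z →
          p :* (S₁ :* w :+ v :* (x :* X :* Y :* Z) :- v :* w) :+ (con 1ℚ :- p) :* (S₂ :* w :+ v :* (X :* (y :* Y) :* Z) :- v :* w)
            :+ v :* (X :* Y :* Z) :* (z :- (p :* x :+ (con 1ℚ :- p) :* y))
          := ((p :* S₁ :+ (con 1ℚ :- p) :* S₂) :* w :+ v :* (X :* Y :* (z :* Z))) :- v :* w)
          refl p S₁ S₂ x y z v w X Y Z)
      where
      rec = vote-potential i j i≢j {A} {B} {x} {y} {z} {v} {w} t 0≤x 0≤y 0≤z 0≤v mean base
      p = pFirst γ π i j
      S₁ = s (vote i j i≢j m (suc a) b A B)
      S₂ = s (vote i j i≢j m a (suc b) A B)
      X = x ^ a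
      Y = y ^ b
      Z = z ^ m

    -- The optimal Chernoff weights √(pWrong / pCorrect) and its inverse are irrational;
    -- 1 - h and 1 + h for h close to γ / 2 lose only a constant factor.
    module _ {h : ℚ} (0≤h : 0ℚ ≤ h) (2h≤γ : h + h ≤ γ) where

      private
        x = 1ℚ - h
        y = 1ℚ + h
        z = 1ℚ - (h * h + h * h)
        ½≤x : ½ ≤ x
        ½≤x = ≤-by-gap (½ * (1ℚ - (h + h))) (*-nonneg 0≤½ (≤⇒0≤ (ℚ.≤-trans 2h≤γ γ≤1)))
          (solve 1 (λ h → con ½ :* (con 1ℚ :- (h :+ h)) := con 1ℚ :- h :- con ½) refl h)
        0≤x = ℚ.≤-trans 0≤½ ½≤x
        1≤y = x≤x+y 1ℚ 0≤h
        0≤y = ℚ.≤-trans 0≤1 1≤y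
        xy≤1 : x * y ≤ 1ℚ
        xy≤1 = ≤-by-gap (h * h) (*-nonneg 0≤h 0≤h) (solve 1 (λ h → h :* h := con 1ℚ :- (con 1ℚ :- h) :* (con 1ℚ :+ h)) refl h)
        z≤xy : z ≤ x * y
        z≤xy = ≤-by-gap (h * h) (*-nonneg 0≤h 0≤h)
          (solve 1 (λ h → h :* h := (con 1ℚ :- h) :* (con 1ℚ :+ h) :- (con 1ℚ :- (h :* h :+ h :* h))) refl h)
        0≤z : 0ℚ ≤ z
        0≤z = ≤-by-gap ((1ℚ - (h + h)) * (1ℚ + h) + h)
          (+-nonneg (*-nonneg (≤⇒0≤ (ℚ.≤-trans 2h≤γ γ≤1)) 0≤y) 0≤h)
          (solve 1 (λ h → (con 1ℚ :- (h :+ h)) :* (con 1ℚ :+ h) :+ h := con 1ℚ :- (h :* h :+ h :* h) :- con 0ℚ) refl h)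
        -- The mean is `1 - γ h`, and `γ ≥ 2 h`.
        mean : (½ + ½ * γ) * x + (1ℚ - (½ + ½ * γ)) * y ≤ z
        mean = ≤-by-gap (h * (γ - (h + h))) (*-nonneg 0≤h (≤⇒0≤ 2h≤γ))
          (solve 2 (λ h g → h :* (g :- (h :+ h)) := con 1ℚ :- (h :* h :+ h :* h) :-
             ((con ½ :+ con ½ :* g) :* (con 1ℚ :- h) :+ (con 1ℚ :- (con ½ :+ con ½ :* g)) :* (con 1ℚ :+ h))) refl h γ)
        mean′ : (½ - ½ * γ) * y + (1ℚ - (½ - ½ * γ)) * x ≤ z
        mean′ = subst (_≤ z) (solve 3 (λ g x y → (con ½ :+ con ½ :* g) :* x :+ (con 1ℚ :- (con ½ :+ con ½ :* g)) :* y :=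
             (con ½ :- con ½ :* g) :* y :+ (con 1ℚ :- (con ½ :- con ½ :* g)) :* x) refl γ x y) mean

      -- The Chernoff error is `z ^ (k + k) / (x y) ^ k`, and `z ≤ x y` reduces it to `z ^ k`. The
      -- hypothesis is this bound multiplied through by `(x y) ^ k`, which is positive and is
      -- cancelled here.
      error-bound : ∀ {v S} k → 0ℚ ≤ v → v * (x * y) ^ k ≤ S * (x * y) ^ k + v * (1ℚ * 1ℚ * z ^ (k ℕ.+ k)) →
                    (1ℚ - z ^ k) * v ≤ S
      error-bound {v} {S} k 0≤v bound = ℚ.*-cancelʳ-≤-pos w {{ℚ.positive 0<w}}
        (≤-by-gap ((S * w + v * (1ℚ * 1ℚ * z ^ (k ℕ.+ k)) - v * w) + v * (Z * (w - Z)))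
          (+-nonneg (≤⇒0≤ bound) (*-nonneg 0≤v (*-nonneg (^-nonneg 0≤z k) (≤⇒0≤ (^-monoˡ-≤ 0≤z z≤xy k)))))
          (trans (cong (λ q → (S * w + v * (1ℚ * 1ℚ * q) - v * w) + v * (Z * (w - Z))) (^-homo-* z k k))
            (solve 4 (λ S w v Z → (S :* w :+ v :* (con 1ℚ :* con 1ℚ :* (Z :* Z)) :- v :* w) :+ v :* (Z :* (w :- Z))
               := S :* w :- (con 1ℚ :- Z) :* v :* w) refl S w v Z)))
        where
        w = (x * y) ^ k
        Z = z ^ k
        0<w : 0ℚ < w
        0<w = ^-pos (*-pos (ℚ.<-≤-trans (ℚ.positive⁻¹ ½) ½≤x) (ℚ.<-≤-trans 0<1 1≤y)) k

      vote-first : ∀ i j i≢j k {A B v} → π ⟨$⟩ʳ i Fin.< π ⟨$⟩ʳ j → 0ℚ ≤ v → v ≤ s A →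
                   (1ℚ - z ^ k) * v ≤ s (vote i j i≢j (k ℕ.+ k) 0 0 A B)
      vote-first i j i≢j k {A} {B} {v} i<j 0≤v v≤A = error-bound k 0≤v
        (vote-potential i j i≢j {A} {B} {x} {y} {z} {v} {w} (k ℕ.+ k) 0≤x 0≤y 0≤z 0≤v
          (subst (λ b → pAnswer γ b * x + (1ℚ - pAnswer γ b) * y ≤ z) (sym (dec-true (π ⟨$⟩ʳ i Fin.<? π ⟨$⟩ʳ j) i<j)) mean)
          base (k ℕ.+ k) 0 0 (ℕ.+-identityʳ (k ℕ.+ k)))
        where
        w = (x * y) ^ k
        0≤w : 0ℚ ≤ w
        0≤w = ^-nonneg (*-nonneg 0≤x 0≤y) k
        base : ∀ a b → a ℕ.+ b ≡ k ℕ.+ k → v * w ≤ s (vote i j i≢j 0 a b A B) * w + v * (x ^ a * y ^ b)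
        base a b eq with b ℕ.<? a
        ... | yes _   = ℚ.≤-trans (mulʳ w 0≤w v≤A) (x≤x+y _ (*-nonneg 0≤v (*-nonneg (^-nonneg 0≤x a) (^-nonneg 0≤y b))))
        ... | no  b≮a = ℚ.≤-trans (mulˡ v 0≤v (potential-≥ 0≤x 1≤y xy≤1 k eq (ℕ.≮⇒≥ b≮a)))
          (subst (_≤ s B * w + v * (x ^ a * y ^ b)) (ℚ.+-identityˡ _)
            (ℚ.+-monoˡ-≤ (v * (x ^ a * y ^ b)) (*-nonneg (successOnℚ-nonneg B) 0≤w)))

      -- The mirror image of `vote-first`, with the weights exchanged. Ties go to `j`, so a tie is
      -- an error only in `vote-first`; `potential-≥` admits equality for that case.
      vote-second : ∀ i j i≢j k {A B v} → π ⟨$⟩ʳ j Fin.< π ⟨$⟩ʳ i → 0ℚ ≤ v → v ≤ s B →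
                   (1ℚ - z ^ k) * v ≤ s (vote i j i≢j (k ℕ.+ k) 0 0 A B)
      vote-second i j i≢j k {A} {B} {v} j<i 0≤v v≤B = error-bound k 0≤v
        (vote-potential i j i≢j {A} {B} {y} {x} {z} {v} {w} (k ℕ.+ k) 0≤y 0≤x 0≤z 0≤v
          (subst (λ b → pAnswer γ b * y + (1ℚ - pAnswer γ b) * x ≤ z) (sym (dec-false (π ⟨$⟩ʳ i Fin.<? π ⟨$⟩ʳ j) (ℕ.<-asym j<i))) mean′)
          base (k ℕ.+ k) 0 0 (ℕ.+-identityʳ (k ℕ.+ k)))
        where
        w = (x * y) ^ k
        0≤w : 0ℚ ≤ w
        0≤w = ^-nonneg (*-nonneg 0≤x 0≤y) k
        base : ∀ a b → a ℕ.+ b ≡ k ℕ.+ k → v * w ≤ s (vote i j i≢j 0 a b A B) * w + v * (y ^ a * x ^ b)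
        base a b eq with b ℕ.<? a
        ... | no  _   = ℚ.≤-trans (mulʳ w 0≤w v≤B) (x≤x+y _ (*-nonneg 0≤v (*-nonneg (^-nonneg 0≤y a) (^-nonneg 0≤x b))))
        ... | yes b<a = ℚ.≤-trans (mulˡ v 0≤v (subst (w ≤_) (ℚ.*-comm (x ^ b) (y ^ a))
            (potential-≥ 0≤x 1≤y xy≤1 k (trans (ℕ.+-comm b a) eq) (ℕ.<⇒≤ b<a))))
          (subst (_≤ s A * w + v * (y ^ a * x ^ b)) (ℚ.+-identityˡ _)
            (ℚ.+-monoˡ-≤ (v * (y ^ a * x ^ b)) (*-nonneg (successOnℚ-nonneg A) 0≤w)))

      shrink-≤ : ∀ {v} k → 0ℚ ≤ v → (1ℚ - z ^ k) * v ≤ v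
      shrink-≤ {v} k 0≤v = ≤-by-gap (z ^ k * v) (*-nonneg (^-nonneg 0≤z k) 0≤v)
        (solve 2 (λ Z v → Z :* v := v :- (con 1ℚ :- Z) :* v) refl (z ^ k) v)

      module _ {μ : Fin n} (μ-min : ∀ j → μ ≢ j → π ⟨$⟩ʳ μ Fin.< π ⟨$⟩ʳ j) where

        match-first : ∀ k j {κ v} → 0ℚ ≤ v → v ≤ s (κ μ) → (1ℚ - z ^ k) * v ≤ s (match k μ j κ)
        match-first k j 0≤v v≤ with μ Fin.≟ j
        ... | yes _   = ℚ.≤-trans (shrink-≤ k 0≤v) v≤
        ... | no  μ≢j = vote-first μ j μ≢j k (μ-min j μ≢j) 0≤v v≤

        match-second : ∀ k i {κ v} → 0ℚ ≤ v → v ≤ s (κ μ) → (1ℚ - z ^ k) * v ≤ s (match k i μ κ)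
        match-second k i 0≤v v≤ with i Fin.≟ μ
        ... | yes refl = ℚ.≤-trans (shrink-≤ k 0≤v) v≤
        ... | no  i≢μ  = vote-second i μ i≢μ k (μ-min i (i≢μ ∘ sym)) 0≤v v≤

        -- Only the one match that `μ` plays costs a factor. Every other match is crossed by
        -- `match-≥`, whoever wins it.
        round-min : ∀ k xs {κ v} → 0ℚ ≤ v → μ ∈ xs → (∀ ws → length ws ≡ ⌈ length xs /2⌉ → μ ∈ ws → v ≤ s (κ ws)) →
                    (1ℚ - z ^ k) * v ≤ s (round k xs κ)
        round-min k (x ∷ []) 0≤v μ∈ v≤κ = ℚ.≤-trans (shrink-≤ k 0≤v) (v≤κ (x ∷ []) refl μ∈)
        round-min k (x ∷ y ∷ xs) 0≤v (here refl) v≤κ =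
          match-first k y 0≤v (round-≥ k xs λ ws eq → v≤κ (μ ∷ ws) (cong suc eq) (here refl))
        round-min k (x ∷ y ∷ xs) 0≤v (there (here refl)) v≤κ =
          match-second k x 0≤v (round-≥ k xs λ ws eq → v≤κ (μ ∷ ws) (cong suc eq) (here refl))
        round-min k (x ∷ y ∷ xs) 0≤v (there (there μ∈)) v≤κ =
          match-≥ k x y λ w → round-min k xs 0≤v μ∈ λ ws eq μ∈ws → v≤κ (w ∷ ws) (cong suc eq) (there μ∈ws)

  -- Success probability of the tournament

  minimum : ∀ {n} → Order (suc n) → Fin (suc n)
  minimum π = π ⟨$⟩ˡ Fin.zero

  rank-minimum : ∀ {n} (π : Order (suc n)) → π ⟨$⟩ʳ minimum π ≡ Fin.zero
  rank-minimum π = inverseʳ π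

  minimum-isMinimum : ∀ {n} (π : Order (suc n)) → IsMinimum π (minimum π)
  minimum-isMinimum π j = subst (Fin._≤ π ⟨$⟩ʳ j) (sym (rank-minimum π)) z≤n

  minimum-< : ∀ {n} (π : Order (suc n)) j → minimum π ≢ j → π ⟨$⟩ʳ minimum π Fin.< π ⟨$⟩ʳ j
  minimum-< π j μ≢j = ℕ.≤∧≢⇒< (minimum-isMinimum π j) λ eq →
    μ≢j (trans (sym (inverseˡ π)) (trans (cong (π ⟨$⟩ˡ_) (Fin.toℕ-injective eq)) (inverseˡ π)))

  module _ {n : ℕ} (π : Order (suc n)) {γ h : ℚ} (0≤h : 0ℚ ≤ h) (2h≤γ : h + h ≤ γ) (γ≤1 : γ ≤ 1ℚ) (M : ℕ) where

    private
      0≤γ = ℚ.≤-trans (+-nonneg 0≤h 0≤h) 2h≤γ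
      η = (1ℚ - (h * h + h * h)) ^ M

    -- With `e = η ^ i`, the invariant closes because `(1 - e) (1 - 2 η e) ≥ 1 - 2 e` once
    -- `2 η ≤ 1`: the slack between `2 e` and `2 η e` pays for the current round.
    tournament-min : 0ℚ ≤ η → η + η ≤ 1ℚ → ∀ f i d xs → length xs ℕ.≤ suc f → minimum π ∈ xs →
                     1ℚ - (η ^ i + η ^ i) ≤ successOnℚ γ π (tournament M f i d xs)
    tournament-min 0≤η 2η≤1 f i d (x ∷ []) _ (here refl) =
      subst (λ b → 1ℚ - (η ^ i + η ^ i) ≤ (if b then 1ℚ else 0ℚ)) (sym (dec-true (isMinimum? π (minimum π)) (minimum-isMinimum π)))
        (≤-by-gap (e + e) (+-nonneg (^-nonneg 0≤η i) (^-nonneg 0≤η i)) (solve 1 (λ e → e :+ e := con 1ℚ :- (con 1ℚ :- (e :+ e))) refl e))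
      where e = η ^ i
    tournament-min 0≤η 2η≤1 zero    i d (x ∷ y ∷ xs) (s≤s ()) μ∈
    tournament-min 0≤η 2η≤1 (suc f) i d (x ∷ y ∷ xs) (s≤s len≤) μ∈ = ℚ.≤-trans
      (≤-by-gap (e * (1ℚ - (η + η)) + e * (η * e + η * e))
        (+-nonneg (*-nonneg 0≤e (≤⇒0≤ 2η≤1)) (*-nonneg 0≤e (+-nonneg (*-nonneg 0≤η 0≤e) (*-nonneg 0≤η 0≤e))))
        (solve 2 (λ e η → e :* (con 1ℚ :- (η :+ η)) :+ e :* (η :* e :+ η :* e) :=
          (con 1ℚ :- e) :* (con 1ℚ :- (η :* e :+ η :* e)) :- (con 1ℚ :- (e :+ e))) refl e η))
      (subst (λ q → (1ℚ - q) * v ≤ successOnℚ γ π (round (M ℕ.* i) (x ∷ y ∷ xs) (tournament M f (suc i) d)))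
        (sym (^-assocʳ (1ℚ - (h * h + h * h)) M i))
        (round-min π 0≤γ γ≤1 0≤h 2h≤γ (minimum-< π) (M ℕ.* i) (x ∷ y ∷ xs) {tournament M f (suc i) d} 0≤v μ∈
          λ ws eq μ∈ws → tournament-min 0≤η 2η≤1 f (suc i) d ws
            -- From two players on, a round removes at least one, so one unit of fuel per round is
            -- enough.
            (subst (ℕ._≤ suc f) (sym eq) (ℕ.≤-trans (s≤s (ℕ.⌈n/2⌉≤n (length xs))) len≤)) μ∈ws))
      where
      e = η ^ i
      v = 1ℚ - (η ^ suc i + η ^ suc i)
      0≤e : 0ℚ ≤ e
      0≤e = ^-nonneg 0≤η i
      η≤1 = ℚ.≤-trans (x≤x+y η 0≤η) 2η≤1
      0≤v : 0ℚ ≤ v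
      0≤v = ≤⇒0≤ (ℚ.≤-trans (ℚ.+-mono-≤ η^≤η η^≤η) 2η≤1)
        where
        η^≤η : η * e ≤ η
        η^≤η = subst (η * e ≤_) (ℚ.*-identityʳ η) (mulˡ η 0≤η (^-≤1 0≤η η≤1 i))

  findMin : ∀ n → ℕ → Algorithm (suc n)
  findMin n M = tournament M n 1 Fin.zero (allFin (suc n))

  findMin-queries : ∀ n M → queries (findMin n M) ℕ.≤ (M ℕ.+ M) ℕ.* (suc n ℕ.* 2)
  findMin-queries n M = ℕ.≤-trans (tournament-queries M n 1 Fin.zero (allFin (suc n)))
    (ℕ.*-monoʳ-≤ (M ℕ.+ M) (ℕ.*-monoˡ-≤ 2 (ℕ.≤-trans (ℕ.pred[n]≤n {length (allFin (suc n))})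
      (ℕ.≤-reflexive (List.length-tabulate {n = suc n} (λ i → i))))))

  module _ {γ h : ℚ} (0≤h : 0ℚ ≤ h) (2h≤γ : h + h ≤ γ) (γ≤1 : γ ≤ 1ℚ) (n M : ℕ) where

    private
      η = (1ℚ - (h * h + h * h)) ^ M

    findMin-success : 0ℚ ≤ η → η + η ≤ 1ℚ → 1ℚ - (η + η) ≤ successℚ γ (findMin n M)
    findMin-success 0≤η 2η≤1 = successℚ-lower {x = γ} (findMin n M) λ π →
      subst (λ q → 1ℚ - (q + q) ≤ successOnℚ γ π (findMin n M)) (ℚ.*-identityʳ η)
        (tournament-min π 0≤h 2h≤γ γ≤1 M 0≤η 2η≤1 n 1 Fin.zero (allFin (suc n))
          (ℕ.≤-reflexive (List.length-tabulate {n = suc n} (λ i → i))) (∈-allFin (minimum π)))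

  -- Choice of the parameters

  -- β bounds the error of a match with 2 S comparisons, and b ^ k is a lower bound
  -- for exp (- k / 80).
  β b : ℚ
  β = ℤ.+ 10 / 13
  b = 1ℚ - (ℤ.+ 1 / 80 + ℤ.+ 1 / 80)

  0≤β : 0ℚ ≤ β
  0≤β = ℚ.≤ᵇ⇒≤ _

  0≤b : 0ℚ ≤ b
  0≤b = ℚ.≤ᵇ⇒≤ _

  β≤b² : β ≤ b * b
  β≤b² = ℚ.≤ᵇ⇒≤ _

  -- Each step multiplies the left side by `β` and the right side by `b * b ≥ β`, so only `C = 4`
  -- has to be computed. The inequality fails at `C = 3`; `c ≥ 10` is what supplies `C ≥ 4`.
  rates : ∀ C → 4 ℕ.≤ C → β ^ C + β ^ C ≤ b ^ (3 ℕ.+ (C ℕ.+ C))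
  rates (suc (suc (suc (suc C)))) (s≤s (s≤s (s≤s (s≤s z≤n)))) = go C
    where
    open ℚ.≤-Reasoning
    go : ∀ C → β ^ (4 ℕ.+ C) + β ^ (4 ℕ.+ C) ≤ b ^ (3 ℕ.+ ((4 ℕ.+ C) ℕ.+ (4 ℕ.+ C)))
    go zero    = ℚ.≤ᵇ⇒≤ _
    go (suc C) = begin
      β * B + β * B      ≡⟨ sym (ℚ.*-distribˡ-+ β B B) ⟩
      β * (B + B)        ≤⟨ mul-mono (+-nonneg (^-nonneg 0≤β (4 ℕ.+ C)) (^-nonneg 0≤β (4 ℕ.+ C))) (*-nonneg 0≤b 0≤b) β≤b² (go C) ⟩
      b * b * D          ≡⟨ ℚ.*-assoc b b D ⟩
      b ^ (2 ℕ.+ (3 ℕ.+ ((4 ℕ.+ C) ℕ.+ (4 ℕ.+ C))))  ≡⟨ cong (λ k → b ^ (8 ℕ.+ k)) (sym (ℕ.+-suc C (4 ℕ.+ C))) ⟩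
      b ^ (3 ℕ.+ ((5 ℕ.+ C) ℕ.+ (5 ℕ.+ C))) ∎
      where
      B = β ^ (4 ℕ.+ C)
      D = b ^ (3 ℕ.+ ((4 ℕ.+ C) ℕ.+ (4 ℕ.+ C)))

  module _ {g : ℚ} (0<g : 0ℚ < g) (g≤1 : g ≤ 1ℚ) where

    private
      G = ℤ.+ 11 / 10 * g
      h = ½ * g
      x = h * h + h * h
      0≤g = ℚ.<⇒≤ 0<g
      0≤h = *-nonneg 0≤½ 0≤g
      0≤x = +-nonneg (*-nonneg 0≤h 0≤h) (*-nonneg 0≤h 0≤h)
      ½x≡ : x ≡ ½ * (g * g)
      ½x≡ = solve 1 (λ g → con ½ :* g :* (con ½ :* g) :+ con ½ :* g :* (con ½ :* g) := con ½ :* (g :* g)) refl g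
      g²≤1 : g * g ≤ 1ℚ
      g²≤1 = mul-mono 0≤g 0≤1 g≤1 g≤1
      x≤1 : x ≤ 1ℚ
      x≤1 = subst (_≤ 1ℚ) (sym ½x≡) (mul-mono {½} {1ℚ} (*-nonneg 0≤g 0≤g) 0≤1 (ℚ.≤ᵇ⇒≤ _) g²≤1)

    0≤1-x : 0ℚ ≤ 1ℚ - x
    0≤1-x = ≤⇒0≤ x≤1

    private
      κ = ℤ.+ 121 / 100
      3/2 = ℤ.+ 3 / 2
      ¼κ⁻¹ = ℤ.+ 25 / 121

      -- `S` is the floor of `3/2` over `G²`. It is not 0, since `G² ≤ 121/100 < 3/2`; hence
      -- `suc S ≤ 2 S` and `S x = S g² / 2 ≥ suc S g² / 4 > (3/2) / (4 κ)`, which exceeds `3/10`.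
      large : ∀ S → 3/2 < ℕtoℚ (suc S) * (G * G) → ℤ.+ 3 / 10 ≤ ℕtoℚ S * x
      large zero lt = ⊥-elim (ℚ.<-irrefl refl (ℚ.<-≤-trans lt (begin
        ℕtoℚ 1 * (G * G)   ≡⟨ solve 1 (λ g → con 1ℚ :* (con (ℤ.+ 11 / 10) :* g :* (con (ℤ.+ 11 / 10) :* g)) := con κ :* (g :* g)) refl g ⟩
        κ * (g * g)        ≤⟨ mul-mono {κ} {3/2} (*-nonneg 0≤g 0≤g) (ℚ.≤ᵇ⇒≤ _) (ℚ.≤ᵇ⇒≤ _) g²≤1 ⟩
        3/2 * 1ℚ           ≡⟨⟩
        3/2                ∎)))
        where open ℚ.≤-Reasoning
      large (suc S) lt = ≤-by-gap (¼κ⁻¹ * (ℕtoℚ (suc (suc S)) * (G * G) - 3/2) + ½ * ½ * (T * (g * g)) + d)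
        (+-nonneg (+-nonneg (*-nonneg 0≤¼κ⁻¹ (≤⇒0≤ (ℚ.<⇒≤ lt)))
          (*-nonneg (*-nonneg 0≤½ 0≤½) (*-nonneg (ℕtoℚ-nonneg S) (*-nonneg 0≤g 0≤g)))) 0≤d)
        (trans (cong (λ q → ¼κ⁻¹ * (q * (G * G) - 3/2) + ½ * ½ * (T * (g * g)) + d) (trans (ℕtoℚ-suc (suc S)) (cong (1ℚ +_) (ℕtoℚ-suc S))))
          (trans (solve 2 (λ g T → con ¼κ⁻¹ :* ((con 1ℚ :+ (con 1ℚ :+ T)) :* (con (ℤ.+ 11 / 10) :* g :* (con (ℤ.+ 11 / 10) :* g)) :- con 3/2)
              :+ con ½ :* con ½ :* (T :* (g :* g)) :+ con d
              := (con 1ℚ :+ T) :* (con ½ :* g :* (con ½ :* g) :+ con ½ :* g :* (con ½ :* g)) :- con (ℤ.+ 3 / 10)) refl g T)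
            (cong (λ q → q * x - ℤ.+ 3 / 10) (sym (ℕtoℚ-suc S)))))
        where
        T = ℕtoℚ S
        d = ¼κ⁻¹ * 3/2 - ℤ.+ 3 / 10
        0≤d : 0ℚ ≤ d
        0≤d = ℚ.≤ᵇ⇒≤ _
        0≤¼κ⁻¹ : 0ℚ ≤ ¼κ⁻¹
        0≤¼κ⁻¹ = ℚ.≤ᵇ⇒≤ _

    repetitions : ∃ λ S → ℕtoℚ S * (G * G) ≤ ℤ.+ 3 / 2 × (1ℚ - x) ^ S ≤ β
    repetitions =
      let S , upper , lower = quotient {G * G} {3/2} (*-pos 0<G 0<G) (ℚ.≤ᵇ⇒≤ _)
          P = (1ℚ - x) ^ S
          0≤P = ^-nonneg 0≤1-x S
          open ℚ.≤-Reasoning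
      in S , upper , (begin
        -- `β = 10/13` is the inverse of `1 + 3/10`, the factor that Bernoulli's inequality
        -- provides.
        P                                  ≡⟨ solve 1 (λ P → P := con β :* (P :* (con 1ℚ :+ con (ℤ.+ 3 / 10)))) refl P ⟩
        β * (P * (1ℚ + ℤ.+ 3 / 10))        ≤⟨ mulˡ β 0≤β (mulˡ P 0≤P (ℚ.+-monoʳ-≤ 1ℚ (large S lower))) ⟩
        β * (P * (1ℚ + ℕtoℚ S * x))        ≤⟨ mulˡ β 0≤β (bernoulli 0≤x x≤1 S) ⟩
        β * 1ℚ                             ≡⟨⟩
        β                                  ∎)
      where
      0<G : 0ℚ < G
      0<G = *-pos (ℚ.positive⁻¹ (ℤ.+ 11 / 10)) 0<g

  -- Rational bounds for the entries of `c` and `γ`.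

  within : ∀ {p q e} → ∣ p - q ∣ ≤ e → q - e ≤ p × p ≤ q + e
  within {p} {q} {e} ∣p-q∣≤e =
    ≤-by-gap (e - (q - p)) (≤⇒0≤ (ℚ.≤-trans (p≤∣p∣ (q - p)) (subst (_≤ e) (∣∣-swap p q) ∣p-q∣≤e)))
      (solve 3 (λ p q e → e :- (q :- p) := p :- (q :- e)) refl p q e) ,
    ≤-by-gap (e - (p - q)) (≤⇒0≤ (ℚ.≤-trans (p≤∣p∣ (p - q)) ∣p-q∣≤e))
      (solve 3 (λ p q e → e :- (p :- q) := q :+ e :- p) refl p q e)

  half-floor-ℚ : ∀ {c} → ℤ.+ 19 / 2 ≤ c → ∃ λ C → 4 ℕ.≤ C × ℕtoℚ C * ℕtoℚ 2 ≤ c × c ≤ ℕtoℚ 2 + ℕtoℚ C * ℕtoℚ 2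
  half-floor-ℚ {c} 19/2≤c =
    let C , lower , upper = quotient {ℕtoℚ 2} {c} (ℚ.positive⁻¹ (ℕtoℚ 2)) (ℚ.≤-trans 0≤19/2 19/2≤c)
    in C , ℕ.≮⇒≥ (λ C<4 → ℚ.<-irrefl {ℤ.+ 19 / 2} refl (ℚ.≤-<-trans 19/2≤c (ℚ.<-≤-trans upper (small C C<4)))) , lower ,
       ℚ.≤-trans (ℚ.<⇒≤ upper) (ℚ.≤-reflexive (trans (cong (_* ℕtoℚ 2) (ℕtoℚ-suc C))
         (solve 2 (λ C t → (con 1ℚ :+ C) :* t := t :+ C :* t) refl (ℕtoℚ C) (ℕtoℚ 2))))
    where
    0≤19/2 : 0ℚ ≤ ℤ.+ 19 / 2
    0≤19/2 = ℚ.≤ᵇ⇒≤ _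
    8≤19/2 : ℕtoℚ 4 * ℕtoℚ 2 ≤ ℤ.+ 19 / 2
    8≤19/2 = ℚ.≤ᵇ⇒≤ _
    small : ∀ C → C ℕ.< 4 → ℕtoℚ (suc C) * ℕtoℚ 2 ≤ ℤ.+ 19 / 2
    small C C<4 = ℚ.≤-trans (mulʳ (ℕtoℚ 2) (ℕtoℚ-nonneg 2) (ℕtoℚ-mono {suc C} {4} C<4)) 8≤19/2

  -- The floor is taken of one entry lowered by `¼`; later entries stay within `¼` of that entry,
  -- hence `2 C ≤ c ≤ 2 C + 5/2`, and `5/2` is rounded up to 3. Likewise `19/2` is 10 less two
  -- quarters.
  half-floor : ∀ c → fromℕ 10 Defs.≤ c → ∃ λ C → 4 ℕ.≤ C × ∃ λ N → ∀ m → N ℕ.≤ m →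
               ℕtoℚ C * ℕtoℚ 2 ≤ seq c m × seq c m ≤ ℕtoℚ (3 ℕ.+ (C ℕ.+ C))
  half-floor c 10≤c = conclude (half-floor-ℚ {seq c N - ¼} (start {seq c N} (g N (ℕ.m≤n⊔m N₁ N₂))))
    where
    ¼ = ½ * ½
    0<¼ : 0ℚ < ¼
    0<¼ = ℚ.positive⁻¹ ¼
    start : ∀ {x} → ℕtoℚ 10 ≤ x + ¼ → ℤ.+ 19 / 2 ≤ x - ¼
    start {x} 10≤ = ≤-by-gap (x + ¼ - ℕtoℚ 10) (≤⇒0≤ 10≤)
      (solve 1 (λ c → c :+ con ¼ :- con (ℕtoℚ 10) := c :- con ¼ :- con (ℤ.+ 19 / 2)) refl x)
    finish : ∀ {x y C} → y ≤ x + ¼ → x - ¼ ≤ ℕtoℚ 2 + C * ℕtoℚ 2 → y ≤ ℕtoℚ 3 + (C + C)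
    finish {x} {y} {C} y≤ x≤ = ≤-by-gap ((x + ¼ - y) + (ℕtoℚ 2 + C * ℕtoℚ 2 - (x - ¼)) + ½)
      (+-nonneg (+-nonneg (≤⇒0≤ y≤) (≤⇒0≤ x≤)) 0≤½)
      (solve 3 (λ x y C → (x :+ con ¼ :- y) :+ (con (ℕtoℚ 2) :+ C :* con (ℕtoℚ 2) :- (x :- con ¼)) :+ con ½
        := (con (ℕtoℚ 3) :+ (C :+ C)) :- y) refl x y C)
    total : ∀ C → ℕtoℚ 3 + (ℕtoℚ C + ℕtoℚ C) ≡ ℕtoℚ (3 ℕ.+ (C ℕ.+ C))
    total C = sym (trans (ℕtoℚ-homo-+ 3 (C ℕ.+ C)) (cong (ℕtoℚ 3 +_) (ℕtoℚ-homo-+ C C)))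
    N₁ = proj₁ (cauchy c ¼ 0<¼)
    f = proj₂ (cauchy c ¼ 0<¼)
    N₂ = proj₁ (10≤c ¼ 0<¼)
    g = proj₂ (10≤c ¼ 0<¼)
    N = N₁ ℕ.⊔ N₂
    conclude : (∃ λ C → 4 ℕ.≤ C × ℕtoℚ C * ℕtoℚ 2 ≤ seq c N - ¼ × seq c N - ¼ ≤ ℕtoℚ 2 + ℕtoℚ C * ℕtoℚ 2) →
               ∃ λ C → 4 ℕ.≤ C × ∃ λ N → ∀ m → N ℕ.≤ m → ℕtoℚ C * ℕtoℚ 2 ≤ seq c m × seq c m ≤ ℕtoℚ (3 ℕ.+ (C ℕ.+ C))
    conclude (C , 4≤C , lower , upper) = C , 4≤C , N , λ m N≤m →
      let close = within {seq c m} {seq c N} (f m N (ℕ.m⊔n≤o⇒m≤o N₁ N₂ N≤m) (ℕ.m≤m⊔n N₁ N₂))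
      in ℚ.≤-trans lower (proj₁ close) , subst (seq c m ≤_) (total C) (finish {seq c N} {seq c m} {ℕtoℚ C} (proj₂ close) upper)

  -- The witness of `0 < γ` contains a rational `d` below the entries, which turns absolute into
  -- relative precision. With `e = d / 40` and `g = a - e`, the later entries are at most
  -- `a + e = g + 2 e`, and `39 e ≤ g` keeps this below `11/10 g`. The maximum with `d` is the
  -- number that `recip` inverts.
  lower-approximation : ∀ γ → (0<γ : 0ℝ Defs.< γ) → γ Defs.≤ 1ℝ → ∃ λ g → 0ℚ < g × g ≤ 1ℚ × ∃ λ N → ∀ m → N ℕ.≤ m →
    g ≤ seq γ m × seq γ m ⊔ proj₁ 0<γ ≤ ℤ.+ 11 / 10 * g
  lower-approximation γ (d , 0<d , N₀ , d≤γ) γ≤1 =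
    let e = d * κ
        0<e = *-pos 0<d (ℚ.positive⁻¹ κ)
        N₁ , f = cauchy γ e 0<e
        N₂ , u = γ≤1 e 0<e
        N₀₁ = N₀ ℕ.⊔ N₁
        N = N₀₁ ℕ.⊔ N₂
        N₀₁≤N = ℕ.m≤m⊔n N₀₁ N₂
        N₁≤N = ℕ.m⊔n≤o⇒n≤o N₀ N₁ N₀₁≤N
        a = seq γ N
        d≤a : d ≤ a
        d≤a = subst (_≤ a) (ℚ.+-identityˡ d) (d≤γ N (ℕ.m⊔n≤o⇒m≤o N₀ N₁ N₀₁≤N))
        39e≤g : ℕtoℚ 39 * e ≤ a - e
        39e≤g = ≤-by-gap (a - d) (≤⇒0≤ d≤a)
          (solve 2 (λ a d → a :- d := a :- d :* con κ :- con (ℕtoℚ 39) :* (d :* con κ)) refl a d)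
        a+e≤ : a + e ≤ ℤ.+ 11 / 10 * (a - e)
        a+e≤ = ≤-by-gap (ℤ.+ 1 / 10 * ((a - e) - ℕtoℚ 39 * e) + ℤ.+ 19 / 10 * e)
          (+-nonneg (*-nonneg {ℤ.+ 1 / 10} (ℚ.≤ᵇ⇒≤ _) (≤⇒0≤ 39e≤g)) (*-nonneg {ℤ.+ 19 / 10} (ℚ.≤ᵇ⇒≤ _) (ℚ.<⇒≤ 0<e)))
          (solve 2 (λ a e → con (ℤ.+ 1 / 10) :* ((a :- e) :- con (ℕtoℚ 39) :* e) :+ con (ℤ.+ 19 / 10) :* e
            := con (ℤ.+ 11 / 10) :* (a :- e) :- (a :+ e)) refl a e)
    in a - e ,
    ℚ.<-≤-trans (*-pos {ℕtoℚ 39} (ℚ.positive⁻¹ (ℕtoℚ 39)) 0<e) 39e≤g ,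
    ≤-by-gap (1ℚ + e - a) (≤⇒0≤ (u N (ℕ.m≤n⊔m N₀₁ N₂))) (solve 2 (λ a e → con 1ℚ :+ e :- a := con 1ℚ :- (a :- e)) refl a e) ,
    N , λ m N≤m →
    let close = within (f m N (ℕ.≤-trans N₁≤N N≤m) N₁≤N)
    in proj₁ close ,
       ℚ.≤-trans (ℚ.⊔-lub (proj₂ close) (ℚ.≤-trans d≤a (x≤x+y a (ℚ.<⇒≤ 0<e)))) a+e≤
    where
    κ = ℤ.+ 1 / 40

  -- Here `u` is the denominator inside `recip` and `i` its inverse. Inserting `(u i)² = 1` exposes
  -- `S u² ≤ S G² ≤ 3/2`, while `2 C ≤ c` turns the remaining factors into `2 c n i²`.
  budget : ∀ {S C n c u i G} → 0ℚ ≤ u → 0ℚ ≤ i → u ≤ G → u * i ≡ 1ℚ → 0ℚ ≤ c →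
           ℕtoℚ S * (G * G) ≤ ℤ.+ 3 / 2 → ℕtoℚ C * ℕtoℚ 2 ≤ c →
           ℕtoℚ ((S ℕ.* C ℕ.+ S ℕ.* C) ℕ.* (n ℕ.* 2)) ≤ ℕtoℚ 3 * c * ℕtoℚ n * (i * i)
  budget {S} {C} {n} {c} {u} {i} {G} 0≤u 0≤i u≤G ui≡1 0≤c S≤ C≤ = begin
    ℕtoℚ ((S ℕ.* C ℕ.+ S ℕ.* C) ℕ.* (n ℕ.* 2))
      ≡⟨ trans (ℕtoℚ-homo-* (S ℕ.* C ℕ.+ S ℕ.* C) (n ℕ.* 2)) (cong₂ _*_
           (trans (ℕtoℚ-homo-+ (S ℕ.* C) (S ℕ.* C)) (cong (λ q → q + q) (ℕtoℚ-homo-* S C))) (ℕtoℚ-homo-* n 2)) ⟩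
    (s * C′ + s * C′) * (N * two)
      ≡⟨ solve 3 (λ s c n → (s :* c :+ s :* c) :* (n :* con two) := (c :* con two) :* ((s :+ s) :* n)) refl s C′ N ⟩
    (C′ * two) * ((s + s) * N)
      ≤⟨ mulʳ ((s + s) * N) (*-nonneg (+-nonneg 0≤s 0≤s) (ℕtoℚ-nonneg n)) C≤ ⟩
    c * ((s + s) * N)
      ≡⟨ cong (λ q → c * ((q + q) * N)) (trans (sym (ℚ.*-identityʳ s)) (cong (s *_) (sym (cong₂ _*_ ui≡1 ui≡1)))) ⟩
    c * ((s * (u * i * (u * i)) + s * (u * i * (u * i))) * N)
      ≡⟨ solve 5 (λ c s u i n → c :* ((s :* (u :* i :* (u :* i)) :+ s :* (u :* i :* (u :* i))) :* n)
           := (c :* n :* con two :* (i :* i)) :* (s :* (u :* u))) refl c s u i N ⟩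
    (c * N * two * (i * i)) * (s * (u * u))
      ≤⟨ mulˡ (c * N * two * (i * i))
           (*-nonneg (*-nonneg (*-nonneg 0≤c (ℕtoℚ-nonneg n)) (ℕtoℚ-nonneg 2)) (*-nonneg 0≤i 0≤i))
           (ℚ.≤-trans (mulˡ s 0≤s (mul-mono 0≤u (ℚ.≤-trans 0≤u u≤G) u≤G u≤G)) S≤) ⟩
    (c * N * two * (i * i)) * (ℤ.+ 3 / 2)
      ≡⟨ solve 3 (λ c n i → (c :* n :* con two :* (i :* i)) :* con (ℤ.+ 3 / 2) := con (ℕtoℚ 3) :* c :* n :* (i :* i)) refl c N i ⟩
    ℕtoℚ 3 * c * N * (i * i) ∎
    where
    open ℚ.≤-Reasoning
    s = ℕtoℚ S
    C′ = ℕtoℚ C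
    N = ℕtoℚ n
    two = ℕtoℚ 2
    0≤s = ℕtoℚ-nonneg S

  -- From ℚ to ℝ

  clamp-close : ∀ {x δ} → 0ℚ ≤ δ → x ≤ 1ℚ + δ → ∣ x - x ⊓ 1ℚ ∣ ≤ δ
  clamp-close {x} {δ} 0≤δ x≤ with ℚ.≤-total x 1ℚ
  ... | inj₁ x≤1 = subst (λ y → ∣ x - y ∣ ≤ δ) (sym (ℚ.p≤q⇒p⊓q≡p x≤1)) (subst (_≤ δ) (sym (∣a-a∣≡0 x)) 0≤δ)
  ... | inj₂ 1≤x = subst (λ y → ∣ x - y ∣ ≤ δ) (sym (ℚ.p≥q⇒p⊓q≡q 1≤x))
    (subst (_≤ δ) (sym (ℚ.0≤p⇒∣p∣≡p (≤⇒0≤ 1≤x)))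
      (≤-by-gap (1ℚ + δ - x) (≤⇒0≤ x≤) (solve 2 (λ x d → con 1ℚ :+ d :- x := d :- (x :- con 1ℚ)) refl x δ)))

  module _ {n : ℕ} {γ c : ℝ} {S C N : ℕ} {g : ℚ} (0<g : 0ℚ < g) (g≤1 : g ≤ 1ℚ) (γ≤1 : γ Defs.≤ 1ℝ)
           (γ-bounds : ∀ m → N ℕ.≤ m → g ≤ seq γ m × seq γ m ≤ 1ℚ + 1ℚ)
           (S-large : (1ℚ - (½ * g * (½ * g) + ½ * g * (½ * g))) ^ S ≤ β)
           (4≤C : 4 ℕ.≤ C) (c-bounds : ∀ m → N ℕ.≤ m → 0ℚ ≤ seq c m × seq c m ≤ ℕtoℚ (3 ℕ.+ (C ℕ.+ C))) where

    private
      a = ℤ.+ 1 / 80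
      A = findMin n (S ℕ.* C)
      h = ½ * g
      z = 1ℚ - (h * h + h * h)
      η = z ^ (S ℕ.* C)
      K = 3 ℕ.+ (C ℕ.+ C)

      0≤z : 0ℚ ≤ z
      0≤z = 0≤1-x 0<g g≤1
      0≤η : 0ℚ ≤ η
      0≤η = ^-nonneg 0≤z (S ℕ.* C)
      η≤β^C : η ≤ β ^ C
      η≤β^C = subst (_≤ β ^ C) (^-assocʳ z S C) (^-monoˡ-≤ (^-nonneg 0≤z S) S-large C)
      2η≤b^K : η + η ≤ b ^ K
      2η≤b^K = ℚ.≤-trans (ℚ.+-mono-≤ η≤β^C η≤β^C) (rates C 4≤C)
      2η≤1 : η + η ≤ 1ℚ
      2η≤1 = ℚ.≤-trans 2η≤b^K (^-≤1 0≤b (ℚ.≤ᵇ⇒≤ _) K)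
      0≤h = *-nonneg 0≤½ (ℚ.<⇒≤ 0<g)

      clamped-success : ∀ {x} → g ≤ x → 1ℚ - (η + η) ≤ successℚ (x ⊓ 1ℚ) A
      clamped-success {x} g≤x = findMin-success {x ⊓ 1ℚ} {h} 0≤h
        (subst (_≤ x ⊓ 1ℚ) (solve 1 (λ g → g := con ½ :* g :+ con ½ :* g) refl g) (ℚ.⊓-glb g≤x g≤1))
        (ℚ.p⊓q≤q x 1ℚ) n (S ℕ.* C) 0≤η 2η≤1

      0≤a : 0ℚ ≤ a
      0≤a = ℚ.≤ᵇ⇒≤ _
      2a≤1 : a + a ≤ 1ℚ
      2a≤1 = ℚ.≤ᵇ⇒≤ _

      combine : ∀ {P E s t ε} → P ≤ E + ½ * ε → η + η ≤ P → 1ℚ - (η + η) ≤ t → t - s ≤ ½ * ε → 1ℚ - E ≤ s + ε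
      combine {P} {E} {s} {t} {ε} P≤ 2η≤P ≤t t-s≤ = ≤-by-gap
        ((E + ½ * ε - P) + (P - (η + η)) + (t - (1ℚ - (η + η))) + (½ * ε - (t - s)))
        (+-nonneg (+-nonneg (+-nonneg (≤⇒0≤ P≤) (≤⇒0≤ 2η≤P)) (≤⇒0≤ ≤t)) (≤⇒0≤ t-s≤))
        (solve 6 (λ P E s t e q → (E :+ con ½ :* e :- P) :+ (P :- q) :+ (t :- (con 1ℚ :- q)) :+ (con ½ :* e :- (t :- s))
           := (s :+ e) :- (con 1ℚ :- E)) refl P E s t ε (η + η))

      ∣∣≤2 : ∀ {x} → 0ℚ ≤ x → x ≤ 1ℚ + 1ℚ → ∣ x ∣ ≤ 1ℚ + 1ℚ
      ∣∣≤2 0≤x x≤2 = subst (_≤ 1ℚ + 1ℚ) (sym (ℚ.0≤p⇒∣p∣≡p 0≤x)) x≤2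

    success-bound : 1ℝ Defs.- exp (Defs.- (fromℚ (ℤ.+ 1 / 80) Defs.* c)) Defs.≤ success γ (findMin n (S ℕ.* C))
    success-bound ε 0<ε = from-lipschitz (successℚ-lipschitz A)
      where
      0<½ε : 0ℚ < ½ * ε
      0<½ε = *-pos (ℚ.positive⁻¹ ½) 0<ε
      from-lipschitz : IsLipschitz (λ x → successℚ x A) →
        ∃ λ N → ∀ m → N ℕ.≤ m → 1ℚ - expSum (- (a * seq c m)) m ≤ seq (success γ A) m + ε
      from-lipschitz (_ , L , _ , 0≤L , _ , lip) =
        -- Half of `ε` pays for clamping `γ`, the other half for the exponential. The argument
        -- `2 + (C + C)` is one less than `K`, because `expSum-neg-lower` adds one.
        from-bounds (shrink L 0≤L (½ * ε) 0<½ε) (expSum-neg-lower 0≤a 2a≤1 (2 ℕ.+ (C ℕ.+ C)) (½ * ε) 0<½ε)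
        where
        from-bounds : (∃ λ δ → 0ℚ < δ × L * δ ≤ ½ * ε) →
          (∃ λ N → ∀ n → N ℕ.≤ n → ∀ t → 0ℚ ≤ t → t ≤ ℕtoℚ K * a → b ^ K ≤ expSum (- t) n + ½ * ε) →
          ∃ λ N → ∀ m → N ℕ.≤ m → 1ℚ - expSum (- (a * seq c m)) m ≤ seq (success γ A) m + ε
        from-bounds (δ , 0<δ , Lδ≤) (N₁ , exp-lower) = N′ ℕ.⊔ N₂ , conclude
          where
          N₂ = proj₁ (γ≤1 δ 0<δ)
          N′ = N ℕ.⊔ N₁
          conclude : ∀ m → N′ ℕ.⊔ N₂ ℕ.≤ m → 1ℚ - expSum (- (a * seq c m)) m ≤ seq (success γ A) m + ε
          conclude m N≤m = subst (λ q → 1ℚ - expSum (- (a * seq c m)) m ≤ q + ε) (sym (seq-success γ m A))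
            (combine {b ^ K} {E} {successℚ x A} {successℚ x′ A} {ε}
              (exp-lower m N₁≤m (a * seq c m) (*-nonneg 0≤a (proj₁ c∈))
                (subst (a * seq c m ≤_) (ℚ.*-comm a (ℕtoℚ K)) (mulˡ a 0≤a (proj₂ c∈))))
              2η≤b^K (clamped-success (proj₁ x∈)) close)
            where
            N′≤m = ℕ.m⊔n≤o⇒m≤o N′ N₂ N≤m
            N₁≤m = ℕ.m⊔n≤o⇒n≤o N N₁ N′≤m
            c∈ = c-bounds m (ℕ.m⊔n≤o⇒m≤o N N₁ N′≤m)
            x∈ = γ-bounds m (ℕ.m⊔n≤o⇒m≤o N N₁ N′≤m)
            E = expSum (- (a * seq c m)) m
            x = seq γ m
            x′ = x ⊓ 1ℚ
            0≤x = ℚ.≤-trans (ℚ.<⇒≤ 0<g) (proj₁ x∈)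
            close : successℚ x′ A - successℚ x A ≤ ½ * ε
            close = begin
              successℚ x′ A - successℚ x A       ≤⟨ p≤∣p∣ _ ⟩
              ∣ successℚ x′ A - successℚ x A ∣   ≡⟨ ∣∣-swap (successℚ x′ A) (successℚ x A) ⟩
              ∣ successℚ x A - successℚ x′ A ∣   ≤⟨ lip x x′ (∣∣≤2 0≤x (proj₂ x∈))
                                                     (∣∣≤2 (ℚ.⊓-glb 0≤x 0≤1) (ℚ.≤-trans (ℚ.p⊓q≤p x 1ℚ) (proj₂ x∈))) ⟩
              L * ∣ x - x′ ∣                     ≤⟨ mulˡ L 0≤L (clamp-close (ℚ.<⇒≤ 0<δ) (proj₂ (γ≤1 δ 0<δ) m (ℕ.m⊔n≤o⇒n≤o N′ N₂ N≤m))) ⟩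
              L * δ                              ≤⟨ Lδ≤ ⟩
              ½ * ε                              ∎
              where open ℚ.≤-Reasoning

  query-bound : ∀ {n S C N} {γ c : ℝ} (0<γ : 0ℝ Defs.< γ) {G} → ℕtoℚ S * (G * G) ≤ ℤ.+ 3 / 2 →
    (∀ m → N ℕ.≤ m → seq γ m ⊔ proj₁ 0<γ ≤ G) → (∀ m → N ℕ.≤ m → ℕtoℚ C * ℕtoℚ 2 ≤ seq c m) →
    fromℕ (queries (findMin n (S ℕ.* C))) Defs.≤ fromℕ 3 Defs.* c Defs.* fromℕ (suc n) Defs.* (recip γ 0<γ Defs.* recip γ 0<γ)
  query-bound {n} {S} {C} {N} {γ} {c} 0<γ@(d , 0<d , _) {G} S≤ γ≤ c≥ ε 0<ε = N , λ m N≤m →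
    let u = seq γ m ⊔ d
        0<u = ⊔-pos d 0<d (seq γ m)
        i = inverse u 0<u
    in ℚ.≤-trans (ℚ.≤-trans (ℕtoℚ-mono (findMin-queries n (S ℕ.* C)))
         (budget {S} {C} {suc n} {seq c m} {u} {i} {G} (ℚ.<⇒≤ 0<u) (ℚ.<⇒≤ (inverse-pos u 0<u)) (γ≤ m N≤m) (*-inverse u 0<u)
           (ℚ.≤-trans (*-nonneg (ℕtoℚ-nonneg C) (ℕtoℚ-nonneg 2)) (c≥ m N≤m)) S≤ (c≥ m N≤m)))
       (x≤x+y _ (ℚ.<⇒≤ 0<ε))

  findMin-works : ∀ n (c : ℝ) → fromℕ 10 Defs.≤ c → (γ : ℝ) (0<γ : 0ℝ Defs.< γ) → γ Defs.≤ 1ℝ →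
    ∃ λ (A : Algorithm (suc n)) →
      fromℕ (queries A) Defs.≤ fromℕ 3 Defs.* c Defs.* fromℕ (suc n) Defs.* (recip γ 0<γ Defs.* recip γ 0<γ)
      × 1ℝ Defs.- exp (Defs.- (fromℚ (ℤ.+ 1 / 80) Defs.* c)) Defs.≤ success γ A
  findMin-works n c 10≤c γ 0<γ γ≤1 =
    case half-floor c 10≤c of λ { (C , 4≤C , N₁ , c∈) →
    case lower-approximation γ 0<γ γ≤1 of λ { (g , 0<g , g≤1 , N₂ , γ∈) →
    case repetitions 0<g g≤1 of λ { (S , S-small , S-large) →
    let N = N₁ ℕ.⊔ N₂
        c∈′ = λ m N≤m → c∈ m (ℕ.m⊔n≤o⇒m≤o N₁ N₂ N≤m)
        γ∈′ = λ m N≤m → γ∈ m (ℕ.m⊔n≤o⇒n≤o N₁ N₂ N≤m)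
    in findMin n (S ℕ.* C) ,
       query-bound {n} {S} {C} {N} {γ} {c} 0<γ {ℤ.+ 11 / 10 * g} S-small (λ m N≤m → proj₂ (γ∈′ m N≤m)) (λ m N≤m → proj₁ (c∈′ m N≤m)) ,
       success-bound {n} {γ} {c} {S} {C} {N} {g} 0<g g≤1 γ≤1
         (λ m N≤m → proj₁ (γ∈′ m N≤m) ,
           ℚ.≤-trans (ℚ.p≤p⊔q (seq γ m) (proj₁ 0<γ)) (ℚ.≤-trans (proj₂ (γ∈′ m N≤m)) (11/10g≤2 0<g g≤1)))
         S-large 4≤C
         (λ m N≤m → ℚ.≤-trans (*-nonneg (ℕtoℚ-nonneg C) (ℕtoℚ-nonneg 2)) (proj₁ (c∈′ m N≤m)) , proj₂ (c∈′ m N≤m)) }}}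
    where
    11/10g≤2 : ∀ {g} → 0ℚ < g → g ≤ 1ℚ → ℤ.+ 11 / 10 * g ≤ 1ℚ + 1ℚ
    11/10g≤2 0<g g≤1 = mul-mono {ℤ.+ 11 / 10} {1ℚ + 1ℚ} (ℚ.<⇒≤ 0<g) (+-nonneg 0≤1 0≤1) (ℚ.≤ᵇ⇒≤ _) g≤1

open import Defs

theorem12 : ∃ λ (a : ℝ) → 0ℝ < a × ∃ λ (n₀ : ℕ) →
    ∀ (n : ℕ) → n₀ ℕ.≤ n →
    ∀ (log-n : ℝ) → IsLog₂ (fromℕ n) log-n →
    ∀ (c : ℝ) → fromℕ 10 ≤ c → c ≤ log-n →
    ∀ (γ : ℝ) → (0<γ : 0ℝ < γ) → γ ≤ 1ℝ →
    ∃ λ (A : Algorithm n) →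
    fromℕ (queries A) ≤ fromℕ 3 * c * fromℕ n * (recip γ 0<γ * recip γ 0<γ)
    × 1ℝ - exp (- (a * c)) ≤ success γ A
-- The threshold 1 excludes the empty input, which has no element to output.
theorem12 = fromℚ (ℤ.+ 1 ℚ./ 80) , (ℤ.+ 1 ℚ./ 80 , ℚ.positive⁻¹ (ℤ.+ 1 ℚ./ 80) , 0 , λ _ _ → ℚ.≤ᵇ⇒≤ _) , 1 ,
  λ { (suc n) _ _ _ c 10≤c _ γ 0<γ γ≤1 → FindMin.findMin-works n c 10≤c γ 0<γ γ≤1 }
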